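{- For every integer $k\ge 0$, $$\frac{\pi}{4}=2\arctan\left(\frac{1}{\phi^{2k+1}}\right)+\arctan\left(\frac{L_{2k+1}-2}{L_{2k+1}+2}\right).$$
   Context: $\phi=\frac{1+\sqrt5}{2}$ is the Golden mean. $(L_m)_{m\ge0}$ is the sequence of Lucas numbers: $L_0=2$, $L_1=1$, $L_m=L_{m-1}+L_{m-2}$ for $m\ge2$. -}

module Defs where

open import Data.Nat as ℕ using (ℕ; zero; suc)
import Data.Nat.Properties as ℕP
open import Data.Integer as ℤ using (ℤ; +_)
import Data.Integer.Properties as ℤP
open import Data.Rational hiding (_≃_)
open import Data.Rational.Properties
open import Data.Rational.Unnormalised as ℚᵘ using (mkℚᵘ; *≡*; *≤*)
import Data.Rational.Unnormalised.Properties as ℚᵘP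
open import Data.Rational.Solver using (module +-*-Solver)
open import Data.Product using (_×_; _,_; proj₁; proj₂; ∃-syntax)
open import Data.Sum using (inj₁; inj₂)
open import Relation.Nullary using (yes; no)
open import Relation.Binary.PropositionalEquality hiding (J)

2ℚ : ℚ
2ℚ = + 2 / 1

fromℕ : ℕ → ℚ
fromℕ n = + n / 1

invSuc : ℕ → ℚ
invSuc n = + 1 / suc n

invPos : (p : ℚ) → 0ℚ < p → ℚ
invPos p 0<p = (1/ p) {{>-nonZero 0<p}}

invPos-inverse : ∀ p 0<p → p * invPos p 0<p ≡ 1ℚ
invPos-inverse p 0<p = *-inverseʳ p {{>-nonZero 0<p}}

invPos-pos : ∀ p 0<p → 0ℚ < invPos p 0<p
invPos-pos p 0<p =
  positive⁻¹ (invPos p 0<p) {{1/pos⇒pos p {{positive 0<p}}}}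

0<1 : 0ℚ < 1ℚ
0<1 = positive⁻¹ 1ℚ

0<½ : 0ℚ < ½
0<½ = positive⁻¹ ½

*-pos : ∀ {p q} → 0ℚ < p → 0ℚ < q → 0ℚ < p * q
*-pos {p} {q} 0<p 0<q =
  positive⁻¹ (p * q) {{pos*pos⇒pos p {{positive 0<p}} q {{positive 0<q}}}}

*-nonNeg : ∀ {p q} → 0ℚ ≤ p → 0ℚ ≤ q → 0ℚ ≤ p * q
*-nonNeg {p} {q} 0≤p 0≤q = nonNegative⁻¹ (p * q)
  {{nonNeg*nonNeg⇒nonNeg p {{nonNegative 0≤p}} q {{nonNegative 0≤q}}}}

*-mono : ∀ {p q r s} → 0ℚ ≤ q → 0ℚ ≤ r → p ≤ q → r ≤ s → p * r ≤ q * s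
*-mono {p} {q} {r} {s} 0≤q 0≤r p≤q r≤s = ≤-trans
  (*-monoʳ-≤-nonNeg r {{nonNegative 0≤r}} p≤q)
  (*-monoˡ-≤-nonNeg q {{nonNegative 0≤q}} r≤s)

∣*∣-mono : ∀ {p q} {a b : ℚ} → ∣ p ∣ ≤ a → ∣ q ∣ ≤ b → ∣ p * q ∣ ≤ a * b
∣*∣-mono {p} {q} {a} {b} p≤a q≤b = subst (_≤ a * b) (sym (∣p*q∣≡∣p∣*∣q∣ p q))
  (*-mono (≤-trans (0≤∣p∣ p) p≤a) (0≤∣p∣ q) p≤a q≤b)

∣+∣-mono : ∀ {p q} {a b : ℚ} → ∣ p ∣ ≤ a → ∣ q ∣ ≤ b → ∣ p + q ∣ ≤ a + b
∣+∣-mono {p} {q} p≤a q≤b = ≤-trans (∣p+q∣≤∣p∣+∣q∣ p q) (+-mono-≤ p≤a q≤b)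

p≤p+nonNeg : ∀ p {q} → 0ℚ ≤ q → p ≤ p + q
p≤p+nonNeg p {q} 0≤q = subst (_≤ p + q) (+-identityʳ p) (+-monoʳ-≤ p 0≤q)

p≤∣p∣ : ∀ p → p ≤ ∣ p ∣
p≤∣p∣ p with ≤-total 0ℚ p
... | inj₁ 0≤p = ≤-reflexive (sym (0≤p⇒∣p∣≡p 0≤p))
... | inj₂ p≤0 = ≤-trans p≤0 (0≤∣p∣ p)

∣p-q∣≡∣q-p∣ : ∀ p q → ∣ p - q ∣ ≡ ∣ q - p ∣
∣p-q∣≡∣q-p∣ p q = trans (sym (∣-p∣≡∣p∣ (p - q))) (cong ∣_∣
  (solve 2 (λ a b → (:- (a :- b)) := b :- a) refl p q))
  where open +-*-Solver

half+half : ∀ p → p * ½ + p * ½ ≡ p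
half+half p = trans (sym (*-distribˡ-+ p ½ ½)) (*-identityʳ p)

scale-cancel : ∀ p q 0<q → p * invPos q 0<q * q ≡ p
scale-cancel p q 0<q = begin
  p * invPos q 0<q * q   ≡⟨ *-assoc p _ q ⟩
  p * (invPos q 0<q * q) ≡⟨ cong (p *_) (trans (*-comm _ q) (invPos-inverse q 0<q)) ⟩
  p * 1ℚ                 ≡⟨ *-identityʳ p ⟩
  p                      ∎
  where open ≡-Reasoning

0≤fromℕ : ∀ n → 0ℚ ≤ fromℕ n
0≤fromℕ n = nonNegative⁻¹ (fromℕ n) {{normalize-nonNeg n 1}}

0<invSuc : ∀ n → 0ℚ < invSuc n
0<invSuc n = positive⁻¹ (invSuc n) {{normalize-pos 1 (suc n)}}

fromℕ-suc : ∀ n → fromℕ (suc n) ≡ fromℕ n + 1ℚ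
fromℕ-suc n = toℚᵘ-injective (begin
  toℚᵘ (fromℕ (suc n))         ≈⟨ toℚᵘ-fromℚᵘ (mkℚᵘ (+ suc n) 0) ⟩
  mkℚᵘ (+ suc n) 0             ≈⟨ *≡* (cong (ℤ._* + 1) (trans (cong +_ (ℕP.+-comm 1 n))
                                    (cong (ℤ._+ + 1) (sym (ℤP.*-identityʳ (+ n)))))) ⟩
  mkℚᵘ (+ n) 0 ℚᵘ.+ ℚᵘ.1ℚᵘ     ≈⟨ ℚᵘP.+-congˡ ℚᵘ.1ℚᵘ (toℚᵘ-fromℚᵘ (mkℚᵘ (+ n) 0)) ⟨
  toℚᵘ (fromℕ n) ℚᵘ.+ ℚᵘ.1ℚᵘ   ≈⟨ toℚᵘ-homo-+ (fromℕ n) 1ℚ ⟨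
  toℚᵘ (fromℕ n + 1ℚ)          ∎)
  where open ℚᵘP.≃-Reasoning

fromℕ*invSuc : ∀ n → fromℕ (suc n) * invSuc n ≡ 1ℚ
fromℕ*invSuc n = toℚᵘ-injective (begin
  toℚᵘ (fromℕ (suc n) * invSuc n)            ≈⟨ toℚᵘ-homo-* (fromℕ (suc n)) (invSuc n) ⟩
  toℚᵘ (fromℕ (suc n)) ℚᵘ.* toℚᵘ (invSuc n)  ≈⟨ ℚᵘP.*-cong (toℚᵘ-fromℚᵘ (mkℚᵘ (+ suc n) 0))
                                                  (toℚᵘ-fromℚᵘ (mkℚᵘ (+ 1) n)) ⟩
  mkℚᵘ (+ suc n) 0 ℚᵘ.* mkℚᵘ (+ 1) n         ≈⟨ *≡* (cong +_ (trans (ℕP.*-identityʳ _)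
                                                  (trans (ℕP.*-identityʳ (suc n))
                                                  (sym (trans (ℕP.*-identityˡ _) (ℕP.*-identityˡ (suc n))))))) ⟩
  ℚᵘ.1ℚᵘ                                     ∎)
  where open ℚᵘP.≃-Reasoning

fromℕ-mono : ∀ {m n} → m ℕ.≤ n → fromℕ m ≤ fromℕ n
fromℕ-mono {m} {n} m≤n = toℚᵘ-cancel-≤ (begin
  toℚᵘ (fromℕ m) ≃⟨ toℚᵘ-fromℚᵘ (mkℚᵘ (+ m) 0) ⟩
  mkℚᵘ (+ m) 0   ≤⟨ *≤* (ℤP.*-monoʳ-≤-nonNeg (+ 1) (ℤ.+≤+ m≤n)) ⟩
  mkℚᵘ (+ n) 0   ≃⟨ toℚᵘ-fromℚᵘ (mkℚᵘ (+ n) 0) ⟨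
  toℚᵘ (fromℕ n) ∎)
  where open ℚᵘP.≤-Reasoning

archimedean : ∀ p → ∃[ n ] p ≤ fromℕ n
archimedean p@(mkℚ a d _) = ℤ.∣ a ∣ , toℚᵘ-cancel-≤ (begin
  mkℚᵘ a d             ≤⟨ *≤* (ℤP.≤-trans (ℤP.*-monoʳ-≤-nonNeg (+ 1) (i≤∣i∣ a))
                            (ℤP.*-monoˡ-≤-nonNeg (+ ℤ.∣ a ∣) (ℤ.+≤+ (ℕ.s≤s ℕ.z≤n)))) ⟩
  mkℚᵘ (+ ℤ.∣ a ∣) 0   ≃⟨ toℚᵘ-fromℚᵘ (mkℚᵘ (+ ℤ.∣ a ∣) 0) ⟨
  toℚᵘ (fromℕ ℤ.∣ a ∣) ∎)
  where
  open ℚᵘP.≤-Reasoning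
  i≤∣i∣ : ∀ i → i ℤ.≤ + ℤ.∣ i ∣
  i≤∣i∣ (+ n)      = ℤP.≤-refl
  i≤∣i∣ ℤ.-[1+ n ] = ℤ.-≤+

invSuc-small : ∀ c ε → 0ℚ ≤ c → 0ℚ < ε →
               ∃[ N ] ∀ n → N ℕ.≤ n → c * invSuc n ≤ ε
invSuc-small c ε 0≤c 0<ε with archimedean (c * invPos ε 0<ε)
... | N , bound = N , λ n N≤n → begin
  c * invSuc n                             ≡⟨ cong (_* invSuc n) (scale-cancel c ε 0<ε) ⟨
  c * invPos ε 0<ε * ε * invSuc n          ≤⟨ *-monoʳ-≤-nonNeg (invSuc n) {{nonNegative (<⇒≤ (0<invSuc n))}}
                                               (*-monoʳ-≤-nonNeg ε {{nonNegative (<⇒≤ 0<ε)}}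
                                                 (≤-trans bound (fromℕ-mono (ℕP.m≤n⇒m≤1+n N≤n)))) ⟩
  fromℕ (suc n) * ε * invSuc n             ≡⟨ solve 3 (λ a b c → a :* b :* c := b :* (a :* c)) refl
                                               (fromℕ (suc n)) ε (invSuc n) ⟩
  ε * (fromℕ (suc n) * invSuc n)           ≡⟨ cong (ε *_) (fromℕ*invSuc n) ⟩
  ε * 1ℚ                                   ≡⟨ *-identityʳ ε ⟩
  ε                                        ∎
  where
  open ≤-Reasoning
  open +-*-Solver

record ℝ : Set where
  constructor mkℝ
  field
    seq    : ℕ → ℚ
    cauchy : ∀ ε → 0ℚ < ε →
             ∃[ N ] ∀ m n → N ℕ.≤ m → N ℕ.≤ n → ∣ seq m - seq n ∣ ≤ ε

open ℝ public

infix 4 _≃_ _<ℝ_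

-- Equality of reals: the difference of the two sequences tends to 0.
_≃_ : ℝ → ℝ → Set
x ≃ y = ∀ ε → 0ℚ < ε →
        ∃[ N ] ∀ n → N ℕ.≤ n → ∣ seq x n - seq y n ∣ ≤ ε

_<ℝ_ : ℝ → ℝ → Set
x <ℝ y = ∃[ ε ] 0ℚ < ε × (∃[ N ] ∀ n → N ℕ.≤ n → seq x n + ε ≤ seq y n)

-- Every tail of a Cauchy sequence starting late enough is bounded.
eventuallyBounded : ∀ x → ∃[ b ] 0ℚ < b ×
                    (∃[ N ] ∀ n → N ℕ.≤ n → ∣ seq x n ∣ ≤ b)
eventuallyBounded x with cauchy x 1ℚ 0<1
... | N , close = 1ℚ + ∣ seq x N ∣
                , <-≤-trans 0<1 (p≤p+nonNeg 1ℚ (0≤∣p∣ (seq x N)))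
                , N
                , λ n N≤n → subst (λ z → ∣ z ∣ ≤ 1ℚ + ∣ seq x N ∣)
                    (solve 2 (λ a b → (a :- b) :+ b := a) refl (seq x n) (seq x N))
                    (∣+∣-mono {seq x n - seq x N} (close n N N≤n ℕP.≤-refl) ≤-refl)
  where open +-*-Solver

fromℚ : ℚ → ℝ
fromℚ q = mkℝ (λ _ → q) λ ε 0<ε → 0 , λ _ _ _ _ →
  subst (_≤ ε) (cong ∣_∣ (sym (+-inverseʳ q))) (<⇒≤ 0<ε)

0ℝ 1ℝ : ℝ
0ℝ = fromℚ 0ℚ
1ℝ = fromℚ 1ℚ

infix  8 -ℝ_
infixl 7 _*ℝ_
infixl 6 _+ℝ_
infixr 9 _^ℝ_

_+ℝ_ : ℝ → ℝ → ℝ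
x +ℝ y = mkℝ (λ n → seq x n + seq y n) λ ε 0<ε →
  let M , xM = cauchy x (ε * ½) (*-pos 0<ε 0<½)
      N , yN = cauchy y (ε * ½) (*-pos 0<ε 0<½)
  in M ℕ.⊔ N , λ m n m≥ n≥ → subst₂ _≤_
       (cong ∣_∣ (solve 4 (λ a b c d → (a :- c) :+ (b :- d) := (a :+ b) :- (c :+ d)) refl
         (seq x m) (seq y m) (seq x n) (seq y n)))
       (half+half ε)
       (∣+∣-mono {seq x m - seq x n}
         (xM m n (ℕP.m⊔n≤o⇒m≤o M N m≥) (ℕP.m⊔n≤o⇒m≤o M N n≥))
         (yN m n (ℕP.m⊔n≤o⇒n≤o M N m≥) (ℕP.m⊔n≤o⇒n≤o M N n≥)))
  where open +-*-Solver

-ℝ_ : ℝ → ℝ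
-ℝ x = mkℝ (λ n → - seq x n) λ ε 0<ε →
  let N , xN = cauchy x ε 0<ε
  in N , λ m n m≥ n≥ → subst (_≤ ε)
       (trans (sym (∣-p∣≡∣p∣ (seq x m - seq x n)))
         (cong ∣_∣ (neg-distrib-+ (seq x m) (- seq x n))))
       (xN m n m≥ n≥)

_*ℝ_ : ℝ → ℝ → ℝ
x *ℝ y = mkℝ (λ n → seq x n * seq y n) λ ε 0<ε →
  let a , 0<a , A , xA = eventuallyBounded x
      b , 0<b , B , yB = eventuallyBounded y
      0<h    = *-pos 0<ε 0<½
      M , xM = cauchy x (ε * ½ * invPos b 0<b) (*-pos 0<h (invPos-pos b 0<b))
      N , yN = cauchy y (ε * ½ * invPos a 0<a) (*-pos 0<h (invPos-pos a 0<a))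
  in (A ℕ.⊔ B) ℕ.⊔ (M ℕ.⊔ N) , λ m n m≥ n≥ →
     let AB≤m = ℕP.m⊔n≤o⇒m≤o (A ℕ.⊔ B) (M ℕ.⊔ N) m≥
         MN≤m = ℕP.m⊔n≤o⇒n≤o (A ℕ.⊔ B) (M ℕ.⊔ N) m≥
         AB≤n = ℕP.m⊔n≤o⇒m≤o (A ℕ.⊔ B) (M ℕ.⊔ N) n≥
         MN≤n = ℕP.m⊔n≤o⇒n≤o (A ℕ.⊔ B) (M ℕ.⊔ N) n≥
     in subst₂ _≤_
       (cong ∣_∣ (solve 4 (λ a b c d → (a :- c) :* d :+ (b :- d) :* a := a :* b :- c :* d) refl
         (seq x m) (seq y m) (seq x n) (seq y n)))
       (trans (cong₂ _+_ (scale-cancel (ε * ½) b 0<b) (scale-cancel (ε * ½) a 0<a)) (half+half ε))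
       (∣+∣-mono {(seq x m - seq x n) * seq y n}
         (∣*∣-mono {seq x m - seq x n}
           (xM m n (ℕP.m⊔n≤o⇒m≤o M N MN≤m) (ℕP.m⊔n≤o⇒m≤o M N MN≤n))
           (yB n (ℕP.m⊔n≤o⇒n≤o A B AB≤n)))
         (∣*∣-mono {seq y m - seq y n}
           (yN m n (ℕP.m⊔n≤o⇒n≤o M N MN≤m) (ℕP.m⊔n≤o⇒n≤o M N MN≤n))
           (xA m (ℕP.m⊔n≤o⇒m≤o A B AB≤m))))
  where open +-*-Solver

_^ℝ_ : ℝ → ℕ → ℝ
x ^ℝ zero  = 1ℝ
x ^ℝ suc n = x *ℝ x ^ℝ n

-- If x is positive, witnessed by a rational ε > 0 with ε ≤ xₙ for all large n,
-- then 1/x is represented by 1/max(ε, xₙ), which equals 1/xₙ for all large n.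
recip : (x : ℝ) → 0ℝ <ℝ x → ℝ
recip x (ε , 0<ε , K , ε≤x) = mkℝ (λ n → invPos (ε ⊔ seq x n) (0<⊔ n)) λ δ 0<δ →
  let 0<δ′   = *-pos 0<δ (*-pos 0<ε 0<ε)
      M , xM = cauchy x (δ * (ε * ε)) 0<δ′
  in K ℕ.⊔ M , λ m n m≥ n≥ →
     let u = ε ⊔ seq x m ; v = ε ⊔ seq x n
         i = invPos u (0<⊔ m) ; j = invPos v (0<⊔ n)
         u≡ = p≤q⇒p⊔q≡q (subst (_≤ seq x m) (+-identityˡ ε) (ε≤x m (ℕP.m⊔n≤o⇒m≤o K M m≥)))
         v≡ = p≤q⇒p⊔q≡q (subst (_≤ seq x n) (+-identityˡ ε) (ε≤x n (ℕP.m⊔n≤o⇒m≤o K M n≥)))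
         close = subst₂ (λ s t → ∣ t - s ∣ ≤ δ * (ε * ε)) (sym u≡) (sym v≡)
                   (xM n m (ℕP.m⊔n≤o⇒n≤o K M n≥) (ℕP.m⊔n≤o⇒n≤o K M m≥))
     in begin
       ∣ i - j ∣                       ≡⟨ cong ∣_∣ (diff u v i j (invPos-inverse u (0<⊔ m)) (invPos-inverse v (0<⊔ n))) ⟩
       ∣ (v - u) * (i * j) ∣           ≤⟨ ∣*∣-mono {v - u} close (∣*∣-mono {i} (inv≤ m) (inv≤ n)) ⟩
       δ * (ε * ε) * (ε⁻¹ * ε⁻¹)       ≡⟨ solve 3 (λ d e f → d :* (e :* e) :* (f :* f) := d :* (e :* f) :* (e :* f)) refl δ ε ε⁻¹ ⟩
       δ * (ε * ε⁻¹) * (ε * ε⁻¹)       ≡⟨ cong (λ z → δ * z * z) (invPos-inverse ε 0<ε) ⟩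
       δ * 1ℚ * 1ℚ                     ≡⟨ trans (*-identityʳ _) (*-identityʳ δ) ⟩
       δ                               ∎
  where
  open ≤-Reasoning
  open +-*-Solver
  0<⊔ : ∀ n → 0ℚ < ε ⊔ seq x n
  0<⊔ n = <-≤-trans 0<ε (p≤p⊔q ε (seq x n))
  ε⁻¹ : ℚ
  ε⁻¹ = invPos ε 0<ε
  inv≤ : ∀ n → ∣ invPos (ε ⊔ seq x n) (0<⊔ n) ∣ ≤ ε⁻¹
  inv≤ n = begin
    ∣ i ∣          ≡⟨ 0≤p⇒∣p∣≡p 0≤i ⟩
    i              ≡⟨ *-identityʳ i ⟨
    i * 1ℚ         ≡⟨ cong (i *_) (invPos-inverse ε 0<ε) ⟨
    i * (ε * ε⁻¹)  ≤⟨ *-monoˡ-≤-nonNeg i {{nonNegative 0≤i}}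
                        (*-monoʳ-≤-nonNeg ε⁻¹ {{nonNegative (<⇒≤ (invPos-pos ε 0<ε))}} (p≤p⊔q ε (seq x n))) ⟩
    i * (u * ε⁻¹)  ≡⟨ solve 3 (λ a b c → a :* (b :* c) := (b :* a) :* c) refl i u ε⁻¹ ⟩
    u * i * ε⁻¹    ≡⟨ cong (_* ε⁻¹) (invPos-inverse u (0<⊔ n)) ⟩
    1ℚ * ε⁻¹       ≡⟨ *-identityˡ ε⁻¹ ⟩
    ε⁻¹            ∎
    where
    u = ε ⊔ seq x n
    i = invPos u (0<⊔ n)
    0≤i = <⇒≤ (invPos-pos u (0<⊔ n))
  diff : ∀ u v i j → u * i ≡ 1ℚ → v * j ≡ 1ℚ → i - j ≡ (v - u) * (i * j)
  diff u v i j ui vj = begin-equality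
    i - j                        ≡⟨ cong₂ _-_ (*-identityʳ i) (*-identityʳ j) ⟨
    i * 1ℚ - j * 1ℚ              ≡⟨ cong₂ (λ a b → i * a - j * b) vj ui ⟨
    i * (v * j) - j * (u * i)    ≡⟨ solve 4 (λ u v i j → i :* (v :* j) :- j :* (u :* i) := (v :- u) :* (i :* j)) refl u v i j ⟩
    (v - u) * (i * j)            ∎

*ℝ-pos : ∀ {x y} → 0ℝ <ℝ x → 0ℝ <ℝ y → 0ℝ <ℝ x *ℝ y
*ℝ-pos {x} {y} (ε , 0<ε , M , xM) (δ , 0<δ , N , yN) =
  ε * δ , *-pos 0<ε 0<δ , M ℕ.⊔ N , λ n n≥ →
    let ε≤x = subst (_≤ seq x n) (+-identityˡ ε) (xM n (ℕP.m⊔n≤o⇒m≤o M N n≥))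
        δ≤y = subst (_≤ seq y n) (+-identityˡ δ) (yN n (ℕP.m⊔n≤o⇒n≤o M N n≥))
    in subst (_≤ seq x n * seq y n) (sym (+-identityˡ (ε * δ)))
         (*-mono (≤-trans (<⇒≤ 0<ε) ε≤x) (<⇒≤ 0<δ) ε≤x δ≤y)

^ℝ-pos : ∀ {x} → 0ℝ <ℝ x → ∀ n → 0ℝ <ℝ x ^ℝ n
^ℝ-pos 0<x zero    = 1ℚ , 0<1 , 0 , λ _ _ → ≤-refl
^ℝ-pos {x} 0<x (suc n) = *ℝ-pos {x} {x ^ℝ n} 0<x (^ℝ-pos {x} 0<x n)

powOverFact : ℚ → ℕ → ℚ
powOverFact x zero    = 1ℚ
powOverFact x (suc j) = powOverFact x j * x * invSuc j

partialSum : (ℕ → ℚ) → ℚ → ℕ → ℚ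
partialSum s x zero    = 0ℚ
partialSum s x (suc n) = partialSum s x n + s n * powOverFact x n

expSum : ℚ → ℕ → ℚ
expSum = partialSum (λ _ → 1ℚ)

∣invSuc∣ : ∀ n → ∣ invSuc n ∣ ≤ invSuc n
∣invSuc∣ n = ≤-reflexive (0≤p⇒∣p∣≡p (<⇒≤ (0<invSuc n)))

powOverFact-nonNeg : ∀ {b} → 0ℚ ≤ b → ∀ j → 0ℚ ≤ powOverFact b j
powOverFact-nonNeg 0≤b zero    = <⇒≤ 0<1
powOverFact-nonNeg 0≤b (suc j) =
  *-nonNeg (*-nonNeg (powOverFact-nonNeg 0≤b j) 0≤b) (<⇒≤ (0<invSuc j))

powOverFact-bound : ∀ {x b} → ∣ x ∣ ≤ b → ∀ j → ∣ powOverFact x j ∣ ≤ powOverFact b j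
powOverFact-bound x≤b zero = ≤-refl
powOverFact-bound {x} x≤b (suc j) = ∣*∣-mono {powOverFact x j * x}
  (∣*∣-mono {powOverFact x j} (powOverFact-bound x≤b j) x≤b) (∣invSuc∣ j)

powOverFact-suc : ∀ b j → fromℕ (suc j) * powOverFact b (suc j) ≡ powOverFact b j * b
powOverFact-suc b j = begin
  fromℕ (suc j) * (powOverFact b j * b * invSuc j)
    ≡⟨ solve 4 (λ n p b i → n :* (p :* b :* i) := p :* b :* (n :* i)) refl
         (fromℕ (suc j)) (powOverFact b j) b (invSuc j) ⟩
  powOverFact b j * b * (fromℕ (suc j) * invSuc j)
    ≡⟨ cong (powOverFact b j * b *_) (fromℕ*invSuc j) ⟩
  powOverFact b j * b * 1ℚ
    ≡⟨ *-identityʳ _ ⟩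
  powOverFact b j * b ∎
  where
  open ≡-Reasoning
  open +-*-Solver

powOverFact-lipschitz : ∀ {x y b} → ∣ x ∣ ≤ b → ∣ y ∣ ≤ b → ∀ j →
  ∣ powOverFact x (suc j) - powOverFact y (suc j) ∣ ≤ ∣ x - y ∣ * powOverFact b j
powOverFact-lipschitz {x} {y} x≤b y≤b zero = ≤-reflexive (trans
  (cong ∣_∣ (solve 2 (λ x y → con 1ℚ :* x :* con 1ℚ :- con 1ℚ :* y :* con 1ℚ := x :- y) refl x y))
  (sym (*-identityʳ ∣ x - y ∣)))
  where open +-*-Solver
powOverFact-lipschitz {x} {y} {b} x≤b y≤b (suc j) = begin
  ∣ p * x * i - q * y * i ∣
    ≡⟨ cong ∣_∣ (solve 5 (λ p q x y i → p :* x :* i :- q :* y :* i := ((p :- q) :* x :+ q :* (x :- y)) :* i) refl p q x y i) ⟩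
  ∣ ((p - q) * x + q * (x - y)) * i ∣
    ≤⟨ ∣*∣-mono {(p - q) * x + q * (x - y)}
         (∣+∣-mono {(p - q) * x}
           (∣*∣-mono {p - q} (powOverFact-lipschitz x≤b y≤b j) x≤b)
           (∣*∣-mono {q} (powOverFact-bound y≤b (suc j)) ≤-refl))
         (∣invSuc∣ (suc j)) ⟩
  (d * powOverFact b j * b + r * d) * i
    ≡⟨ cong (λ z → (z + r * d) * i) (trans (*-assoc d _ b) (cong (d *_) (sym (powOverFact-suc b j)))) ⟩
  (d * (fromℕ (suc j) * r) + r * d) * i
    ≡⟨ solve 4 (λ d n r i → (d :* (n :* r) :+ r :* d) :* i := d :* r :* ((n :+ con 1ℚ) :* i)) refl d (fromℕ (suc j)) r i ⟩
  d * r * ((fromℕ (suc j) + 1ℚ) * i)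
    ≡⟨ cong (d * r *_) (trans (cong (_* i) (sym (fromℕ-suc (suc j)))) (fromℕ*invSuc (suc j))) ⟩
  d * r * 1ℚ
    ≡⟨ *-identityʳ _ ⟩
  d * r ∎
  where
  open ≤-Reasoning
  open +-*-Solver
  p = powOverFact x (suc j)
  q = powOverFact y (suc j)
  r = powOverFact b (suc j)
  d = ∣ x - y ∣
  i = invSuc (suc j)

expSum-step : ∀ {b} → 0ℚ ≤ b → ∀ n → expSum b n ≤ expSum b (suc n)
expSum-step {b} 0≤b n = p≤p+nonNeg (expSum b n)
  (*-nonNeg (<⇒≤ 0<1) (powOverFact-nonNeg 0≤b n))

expSum-mono : ∀ {b} → 0ℚ ≤ b → ∀ n i → expSum b n ≤ expSum b (i ℕ.+ n)
expSum-mono 0≤b n zero    = ≤-refl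
expSum-mono 0≤b n (suc i) = ≤-trans (expSum-mono 0≤b n i) (expSum-step 0≤b (i ℕ.+ n))

-- Past index 2b the terms at least halve at each step, so that
-- expSum b n + 2 bⁿ/n! is nonincreasing there.
module Tail {b : ℚ} (0≤b : 0ℚ ≤ b) where

  upper : ℕ → ℚ
  upper n = expSum b n + 2ℚ * powOverFact b n

  cutoff : ℕ
  cutoff = proj₁ (archimedean (2ℚ * b))

  halving : ∀ n → cutoff ℕ.≤ n → 2ℚ * powOverFact b (suc n) ≤ powOverFact b n
  halving n s≤n = begin
    2ℚ * (p * b * i)              ≡⟨ solve 4 (λ t p b i → t :* (p :* b :* i) := p :* i :* (t :* b)) refl 2ℚ p b i ⟩
    p * i * (2ℚ * b)              ≤⟨ *-monoˡ-≤-nonNeg (p * i) {{nonNegative (*-nonNeg (powOverFact-nonNeg 0≤b n) (<⇒≤ (0<invSuc n)))}}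
                                       (≤-trans (proj₂ (archimedean (2ℚ * b))) (fromℕ-mono (ℕP.m≤n⇒m≤1+n s≤n))) ⟩
    p * i * fromℕ (suc n)         ≡⟨ solve 3 (λ p i n → p :* i :* n := p :* (n :* i)) refl p i (fromℕ (suc n)) ⟩
    p * (fromℕ (suc n) * i)       ≡⟨ cong (p *_) (fromℕ*invSuc n) ⟩
    p * 1ℚ                        ≡⟨ *-identityʳ p ⟩
    p                             ∎
    where
    open ≤-Reasoning
    open +-*-Solver
    p = powOverFact b n
    i = invSuc n

  upper-step : ∀ n → cutoff ℕ.≤ n → upper (suc n) ≤ upper n
  upper-step n s≤n = begin
    expSum b n + 1ℚ * p + 2ℚ * powOverFact b (suc n) ≤⟨ +-monoʳ-≤ (expSum b n + 1ℚ * p) (halving n s≤n) ⟩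
    expSum b n + 1ℚ * p + p                          ≡⟨ solve 2 (λ e p → e :+ con 1ℚ :* p :+ p := e :+ con 2ℚ :* p) refl (expSum b n) p ⟩
    expSum b n + 2ℚ * p                              ∎
    where
    open ≤-Reasoning
    open +-*-Solver
    p = powOverFact b n

  upper-mono : ∀ n i → cutoff ℕ.≤ n → upper (i ℕ.+ n) ≤ upper n
  upper-mono n zero    s≤n = ≤-refl
  upper-mono n (suc i) s≤n = ≤-trans
    (upper-step (i ℕ.+ n) (ℕP.≤-trans s≤n (ℕP.m≤n+m n i))) (upper-mono n i s≤n)

  expSum≤upper : ∀ n → expSum b n ≤ upper n
  expSum≤upper n = p≤p+nonNeg (expSum b n)
    (*-nonNeg (<⇒≤ (positive⁻¹ 2ℚ)) (powOverFact-nonNeg 0≤b n))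

  bound : ℚ
  bound = upper cutoff

  expSum≤bound : ∀ n → expSum b n ≤ bound
  expSum≤bound n = ≤-trans (expSum-mono 0≤b n cutoff)
    (subst (λ k → expSum b k ≤ bound) (ℕP.+-comm n cutoff)
      (≤-trans (expSum≤upper (n ℕ.+ cutoff)) (upper-mono cutoff n ℕP.≤-refl)))

  powOverFact≤bound : ∀ n → powOverFact b n ≤ bound
  powOverFact≤bound n = ≤-trans
    (subst₂ _≤_ (+-identityˡ _) (cong (λ z → expSum b n + z) (sym (*-identityˡ _)))
      (+-monoˡ-≤ (powOverFact b n) (expSum-mono-0 n)))
    (expSum≤bound (suc n))
    where
    expSum-mono-0 : ∀ n → 0ℚ ≤ expSum b n
    expSum-mono-0 n = subst (λ k → 0ℚ ≤ expSum b k) (ℕP.+-identityʳ n) (expSum-mono 0≤b 0 n)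

  0<bound : 0ℚ < bound
  0<bound = <-≤-trans 0<1 (powOverFact≤bound 0)

  tail : ∀ n i → cutoff ℕ.≤ n → expSum b (i ℕ.+ n) - expSum b n ≤ 2ℚ * powOverFact b n
  tail n i c≤n = subst (expSum b (i ℕ.+ n) - expSum b n ≤_)
    (solve 2 (λ e p → e :+ p :- e := p) refl (expSum b n) (2ℚ * powOverFact b n))
    (+-monoˡ-≤ (- expSum b n) (≤-trans (expSum≤upper (i ℕ.+ n)) (upper-mono n i c≤n)))
    where open +-*-Solver

  term-small : ∀ K → (∀ n → powOverFact b n ≤ K) →
               ∀ n → 2ℚ * powOverFact b (suc n) ≤ 2ℚ * (K * b) * invSuc n
  term-small K p≤K n = subst (_≤ 2ℚ * (K * b) * invSuc n)
    (solve 4 (λ t p b i → t :* (p :* b) :* i := t :* (p :* b :* i)) refl 2ℚ (powOverFact b n) b (invSuc n))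
    (*-monoʳ-≤-nonNeg (invSuc n) {{nonNegative (<⇒≤ (0<invSuc n))}}
      (*-monoˡ-≤-nonNeg 2ℚ (*-monoʳ-≤-nonNeg b {{nonNegative 0≤b}} (p≤K n))))
    where open +-*-Solver

  tail-small′ : ∀ K → 0ℚ < K → (∀ n → powOverFact b n ≤ K) → ∀ ε → 0ℚ < ε →
    ∃[ N ] ∀ n i → N ℕ.≤ n → expSum b (i ℕ.+ n) - expSum b n ≤ ε
  tail-small′ K 0<K p≤K ε 0<ε = go (invSuc-small (2ℚ * (K * b)) ε
           (*-nonNeg (<⇒≤ (positive⁻¹ 2ℚ)) (*-nonNeg (<⇒≤ 0<K) 0≤b)) 0<ε)
    where
    go : (∃[ M ] ∀ n → M ℕ.≤ n → 2ℚ * (K * b) * invSuc n ≤ ε) →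
         ∃[ N ] ∀ n i → N ℕ.≤ n → expSum b (i ℕ.+ n) - expSum b n ≤ ε
    go (M , small) = suc (cutoff ℕ.⊔ M) , λ where
      (suc n) i (ℕ.s≤s n≥) →
        ≤-trans (tail (suc n) i (ℕP.m≤n⇒m≤1+n (ℕP.m⊔n≤o⇒m≤o cutoff M n≥)))
          (≤-trans (term-small K p≤K n) (small n (ℕP.m⊔n≤o⇒n≤o cutoff M n≥)))

  tail-small : ∀ ε → 0ℚ < ε →
    ∃[ N ] ∀ n i → N ℕ.≤ n → expSum b (i ℕ.+ n) - expSum b n ≤ ε
  tail-small = tail-small′ bound 0<bound powOverFact≤bound

module _ (s : ℕ → ℚ) (∣s∣≤1 : ∀ j → ∣ s j ∣ ≤ 1ℚ) where

  partialSum-tail : ∀ {x b} → ∣ x ∣ ≤ b → ∀ n i →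
    ∣ partialSum s x (i ℕ.+ n) - partialSum s x n ∣ ≤ expSum b (i ℕ.+ n) - expSum b n
  partialSum-tail {x} {b} x≤b n zero =
    ≤-reflexive (trans (cong ∣_∣ (+-inverseʳ (partialSum s x n))) (sym (+-inverseʳ (expSum b n))))
  partialSum-tail {x} {b} x≤b n (suc i) = subst₂ _≤_
    (cong ∣_∣ (solve 3 (λ a b c → (a :- b) :+ c := a :+ c :- b) refl
      (partialSum s x k) (partialSum s x n) (s k * powOverFact x k)))
    (solve 3 (λ a b c → (a :- b) :+ c := a :+ c :- b) refl
      (expSum b k) (expSum b n) (1ℚ * powOverFact b k))
    (∣+∣-mono {partialSum s x k - partialSum s x n} (partialSum-tail x≤b n i)
      (∣*∣-mono {s k} (∣s∣≤1 k) (powOverFact-bound x≤b k)))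
    where
    open +-*-Solver
    k = i ℕ.+ n

  partialSum-lipschitz : ∀ {x y b} → ∣ x ∣ ≤ b → ∣ y ∣ ≤ b → ∀ n →
    ∣ partialSum s x (suc n) - partialSum s y (suc n) ∣ ≤ ∣ x - y ∣ * expSum b n
  partialSum-lipschitz {x} {y} x≤b y≤b zero = ≤-reflexive (trans
    (cong ∣_∣ (+-inverseʳ (0ℚ + s 0 * 1ℚ))) (sym (*-zeroʳ ∣ x - y ∣)))
  partialSum-lipschitz {x} {y} {b} x≤b y≤b (suc n) = subst₂ _≤_
    (cong ∣_∣ (solve 5 (λ a b c p q → (a :- b) :+ c :* (p :- q) := a :+ c :* p :- (b :+ c :* q)) refl
      (partialSum s x (suc n)) (partialSum s y (suc n)) (s (suc n)) (powOverFact x (suc n)) (powOverFact y (suc n))))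
    (solve 3 (λ d e p → d :* e :+ con 1ℚ :* (d :* p) := d :* (e :+ con 1ℚ :* p)) refl
      ∣ x - y ∣ (expSum b n) (powOverFact b n))
    (∣+∣-mono {partialSum s x (suc n) - partialSum s y (suc n)} (partialSum-lipschitz x≤b y≤b n)
      (∣*∣-mono {s (suc n)} (∣s∣≤1 (suc n)) (powOverFact-lipschitz x≤b y≤b n)))
    where open +-*-Solver

  -- Σ sⱼ xʲ/j!, represented by its n-th partial sum at the n-th approximation of x.
  powerSeries : ℝ → ℝ
  powerSeries x = mkℝ f λ ε 0<ε →
    let 0<h    = *-pos 0<ε 0<½
        M , xM = cauchy x (ε * ½ * invPos bound 0<bound) (*-pos 0<h (invPos-pos bound 0<bound))
        N , tN = tail-small (ε * ½) 0<h
        P      = suc ((B ℕ.⊔ M) ℕ.⊔ N)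
        near : ∀ n i → P ℕ.≤ n → ∣ f (i ℕ.+ n) - f n ∣ ≤ ε
        near n i n≥ = near′ ε xM tN n i n≥
    in P , λ m n m≥ n≥ → symmetrise ε P near m n m≥ n≥
    where
    open +-*-Solver
    f : ℕ → ℚ
    f n = partialSum s (seq x n) n
    b = proj₁ (eventuallyBounded x)
    0<b = proj₁ (proj₂ (eventuallyBounded x))
    B = proj₁ (proj₂ (proj₂ (eventuallyBounded x)))
    x≤b = proj₂ (proj₂ (proj₂ (eventuallyBounded x)))
    open Tail (<⇒≤ 0<b)

    near′ : ∀ ε {M N} →
      (∀ m n → M ℕ.≤ m → M ℕ.≤ n → ∣ seq x m - seq x n ∣ ≤ ε * ½ * invPos bound 0<bound) →
      (∀ n i → N ℕ.≤ n → expSum b (i ℕ.+ n) - expSum b n ≤ ε * ½) →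
      ∀ n i → suc ((B ℕ.⊔ M) ℕ.⊔ N) ℕ.≤ n → ∣ f (i ℕ.+ n) - f n ∣ ≤ ε
    near′ ε {M} {N} xM tN (suc n) i (ℕ.s≤s n≥) = subst₂ _≤_
      (cong ∣_∣ (solve 3 (λ a b c → (a :- b) :+ (b :- c) := a :- c) refl
        (partialSum s (seq x m) m) (partialSum s (seq x m) (suc n)) (partialSum s (seq x (suc n)) (suc n))))
      (half+half ε)
      (∣+∣-mono {partialSum s (seq x m) m - partialSum s (seq x m) (suc n)}
        (≤-trans (partialSum-tail xm≤b (suc n) i) (tN (suc n) i (ℕP.m≤n⇒m≤1+n (ℕP.m⊔n≤o⇒n≤o (B ℕ.⊔ M) N n≥))))
        (≤-trans (partialSum-lipschitz xm≤b (x≤b (suc n) B≤n) n)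
          (subst (∣ seq x m - seq x (suc n) ∣ * expSum b n ≤_) (scale-cancel (ε * ½) bound 0<bound)
            (*-mono (≤-trans (0≤∣p∣ (seq x m - seq x (suc n))) dx) 0≤e dx (expSum≤bound n)))))
      where
      m = i ℕ.+ suc n
      BM≤n = ℕP.m⊔n≤o⇒m≤o (B ℕ.⊔ M) N n≥
      B≤n : B ℕ.≤ suc n
      B≤n = ℕP.m≤n⇒m≤1+n (ℕP.m⊔n≤o⇒m≤o B M BM≤n)
      M≤n : M ℕ.≤ suc n
      M≤n = ℕP.m≤n⇒m≤1+n (ℕP.m⊔n≤o⇒n≤o B M BM≤n)
      n≤m : suc n ℕ.≤ m
      n≤m = ℕP.m≤n+m (suc n) i
      xm≤b = x≤b m (ℕP.≤-trans B≤n n≤m)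
      dx = xM m (suc n) (ℕP.≤-trans M≤n n≤m) M≤n
      0≤e : 0ℚ ≤ expSum b n
      0≤e = subst (λ k → 0ℚ ≤ expSum b k) (ℕP.+-identityʳ n) (expSum-mono (<⇒≤ 0<b) 0 n)

    symmetrise : ∀ ε P → (∀ n i → P ℕ.≤ n → ∣ f (i ℕ.+ n) - f n ∣ ≤ ε) →
      ∀ m n → P ℕ.≤ m → P ℕ.≤ n → ∣ f m - f n ∣ ≤ ε
    symmetrise ε P near m n m≥ n≥ with ℕP.≤-total n m
    ... | inj₁ n≤m = subst (λ k → ∣ f k - f n ∣ ≤ ε) (ℕP.m∸n+n≡m n≤m) (near n (m ℕ.∸ n) n≥)
    ... | inj₂ m≤n = subst (_≤ ε) (∣p-q∣≡∣q-p∣ (f n) (f m))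
                       (subst (λ k → ∣ f k - f m ∣ ≤ ε) (ℕP.m∸n+n≡m m≤n) (near m (n ℕ.∸ m) m≥))

-- The values at 0 of the successive derivatives of sin and of cos:
-- sin x = Σ sinSign j · xʲ/j!  and  cos x = Σ cosSign j · xʲ/j!.
sinSign cosSign : ℕ → ℚ
sinSign zero          = 0ℚ
sinSign (suc zero)    = 1ℚ
sinSign (suc (suc j)) = - sinSign j
cosSign zero          = 1ℚ
cosSign (suc zero)    = 0ℚ
cosSign (suc (suc j)) = - cosSign j

∣sinSign∣≤1 : ∀ j → ∣ sinSign j ∣ ≤ 1ℚ
∣sinSign∣≤1 zero          = <⇒≤ 0<1
∣sinSign∣≤1 (suc zero)    = ≤-refl
∣sinSign∣≤1 (suc (suc j)) = subst (_≤ 1ℚ) (sym (∣-p∣≡∣p∣ (sinSign j))) (∣sinSign∣≤1 j)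

∣cosSign∣≤1 : ∀ j → ∣ cosSign j ∣ ≤ 1ℚ
∣cosSign∣≤1 zero          = ≤-refl
∣cosSign∣≤1 (suc zero)    = <⇒≤ 0<1
∣cosSign∣≤1 (suc (suc j)) = subst (_≤ 1ℚ) (sym (∣-p∣≡∣p∣ (cosSign j))) (∣cosSign∣≤1 j)

sin cos : ℝ → ℝ
sin = powerSeries sinSign ∣sinSign∣≤1
cos = powerSeries cosSign ∣cosSign∣≤1

tan : (θ : ℝ) → 0ℝ <ℝ cos θ → ℝ
tan θ 0<cosθ = sin θ *ℝ recip (cos θ) 0<cosθ

-- π/2 is the first positive zero of cos.
record IsPi (π : ℝ) : Set where
  field
    positive-π : 0ℝ <ℝ π
    cos-zero   : cos (fromℚ ½ *ℝ π) ≃ 0ℝ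
    cos-first  : ∀ x → 0ℝ <ℝ x → x <ℝ fromℚ ½ *ℝ π → 0ℝ <ℝ cos x

-- arctan x is the θ in (-π/2, π/2) with tan θ = x.
record IsArctan (π : ℝ) (arctan : ℝ → ℝ) : Set where
  field
    arctan-lower : ∀ x → -ℝ (fromℚ ½ *ℝ π) <ℝ arctan x
    arctan-upper : ∀ x → arctan x <ℝ fromℚ ½ *ℝ π
    -- redundant (cos is positive on (-π/2, π/2)), needed to form tan
    cos-arctan   : ∀ x → 0ℝ <ℝ cos (arctan x)
    tan-arctan   : ∀ x → tan (arctan x) (cos-arctan x) ≃ x

isqrt : ℕ → ℕ
isqrt zero = 0
isqrt (suc n) with suc (isqrt n) ℕ.* suc (isqrt n) ℕ.≤? suc n
... | yes _ = suc (isqrt n)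
... | no  _ = isqrt n

isqrt-lower : ∀ n → isqrt n ℕ.* isqrt n ℕ.≤ n
isqrt-lower zero = ℕ.z≤n
isqrt-lower (suc n) with suc (isqrt n) ℕ.* suc (isqrt n) ℕ.≤? suc n
... | yes p = p
... | no  _ = ℕP.m≤n⇒m≤1+n (isqrt-lower n)

isqrt-upper : ∀ n → n ℕ.< suc (isqrt n) ℕ.* suc (isqrt n)
isqrt-upper zero = ℕ.s≤s ℕ.z≤n
isqrt-upper (suc n) with suc (isqrt n) ℕ.* suc (isqrt n) ℕ.≤? suc n
... | yes _ = ℕP.≤-<-trans (isqrt-upper n)
                (ℕP.*-mono-< (ℕP.n<1+n (suc (isqrt n))) (ℕP.n<1+n (suc (isqrt n))))
... | no ¬p = ℕP.≰⇒> ¬p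

fromℕ-* : ∀ m n → fromℕ (m ℕ.* n) ≡ fromℕ m * fromℕ n
fromℕ-* zero    n = sym (*-zeroˡ (fromℕ n))
fromℕ-* (suc m) n = begin
  fromℕ (n ℕ.+ m ℕ.* n)              ≡⟨ fromℕ-+ n (m ℕ.* n) ⟩
  fromℕ n + fromℕ (m ℕ.* n)          ≡⟨ cong (λ z → fromℕ n + z) (fromℕ-* m n) ⟩
  fromℕ n + fromℕ m * fromℕ n        ≡⟨ solve 2 (λ m n → n :+ m :* n := (m :+ con 1ℚ) :* n) refl (fromℕ m) (fromℕ n) ⟩
  (fromℕ m + 1ℚ) * fromℕ n           ≡⟨ cong (_* fromℕ n) (fromℕ-suc m) ⟨
  fromℕ (suc m) * fromℕ n            ∎
  where
  open ≡-Reasoning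
  open +-*-Solver
  fromℕ-+ : ∀ m n → fromℕ (m ℕ.+ n) ≡ fromℕ m + fromℕ n
  fromℕ-+ zero    n = sym (+-identityˡ (fromℕ n))
  fromℕ-+ (suc m) n = begin
    fromℕ (suc (m ℕ.+ n))     ≡⟨ fromℕ-suc (m ℕ.+ n) ⟩
    fromℕ (m ℕ.+ n) + 1ℚ      ≡⟨ cong (_+ 1ℚ) (fromℕ-+ m n) ⟩
    fromℕ m + fromℕ n + 1ℚ    ≡⟨ solve 2 (λ m n → m :+ n :+ con 1ℚ := m :+ con 1ℚ :+ n) refl (fromℕ m) (fromℕ n) ⟩
    fromℕ m + 1ℚ + fromℕ n    ≡⟨ cong (_+ fromℕ n) (fromℕ-suc m) ⟨
    fromℕ (suc m) + fromℕ n   ∎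

fraction-≤ : ∀ {i j m n} → i ℕ.* suc n ℕ.≤ j ℕ.* suc m →
             fromℕ i * invSuc m ≤ fromℕ j * invSuc n
fraction-≤ {i} {j} {m} {n} in≤jm = subst₂ _≤_
  (clear i n m) (trans (cong (fromℕ (j ℕ.* suc m) *_) (*-comm (invSuc m) (invSuc n))) (clear j m n))
  (*-monoʳ-≤-nonNeg (invSuc m * invSuc n)
    {{nonNegative (<⇒≤ (*-pos (0<invSuc m) (0<invSuc n)))}} (fromℕ-mono in≤jm))
  where
  open ≡-Reasoning
  open +-*-Solver
  clear : ∀ i n m → fromℕ (i ℕ.* suc n) * (invSuc m * invSuc n) ≡ fromℕ i * invSuc m
  clear i n m = begin
    fromℕ (i ℕ.* suc n) * (invSuc m * invSuc n)
      ≡⟨ cong (_* (invSuc m * invSuc n)) (fromℕ-* i (suc n)) ⟩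
    fromℕ i * fromℕ (suc n) * (invSuc m * invSuc n)
      ≡⟨ solve 4 (λ i n a b → i :* n :* (a :* b) := i :* a :* (n :* b)) refl (fromℕ i) (fromℕ (suc n)) (invSuc m) (invSuc n) ⟩
    fromℕ i * invSuc m * (fromℕ (suc n) * invSuc n)
      ≡⟨ cong (fromℕ i * invSuc m *_) (fromℕ*invSuc n) ⟩
    fromℕ i * invSuc m * 1ℚ
      ≡⟨ *-identityʳ _ ⟩
    fromℕ i * invSuc m ∎

-- √a is the limit of ⌊√(a N²)⌋ / N, where N = n + 1.
sqrtNum : ℕ → ℕ → ℕ
sqrtNum a n = isqrt (a ℕ.* (suc n ℕ.* suc n))

sqrtApprox : ℕ → ℕ → ℚ
sqrtApprox a n = fromℕ (sqrtNum a n) * invSuc n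

0≤sqrtApprox : ∀ a n → 0ℚ ≤ sqrtApprox a n
0≤sqrtApprox a n = *-nonNeg (0≤fromℕ (sqrtNum a n)) (<⇒≤ (0<invSuc n))

sqrtApprox-≤ : ∀ a m n → sqrtApprox a m ≤ sqrtApprox a n + invSuc n
sqrtApprox-≤ a m n = subst (sqrtApprox a m ≤_) rhs (fraction-≤ {sqrtNum a m} {suc (sqrtNum a n)} {m} {n} cross)
  where
  open +-*-Solver
  M = suc m
  N = suc n
  I = sqrtNum a m
  J = suc (sqrtNum a n)
  rhs : fromℕ J * invSuc n ≡ sqrtApprox a n + invSuc n
  rhs = trans (cong (_* invSuc n) (fromℕ-suc (sqrtNum a n)))
    (solve 2 (λ k i → (k :+ con 1ℚ) :* i := k :* i :+ i) refl (fromℕ (sqrtNum a n)) (invSuc n))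
  square-* : ∀ x y → (x ℕ.* y) ℕ.* (x ℕ.* y) ≡ (x ℕ.* x) ℕ.* (y ℕ.* y)
  square-* x y = ℕP.[m*n]*[o*p]≡[m*o]*[n*p] x y x y
  squares : (I ℕ.* N) ℕ.* (I ℕ.* N) ℕ.< (J ℕ.* M) ℕ.* (J ℕ.* M)
  squares = begin-strict
    (I ℕ.* N) ℕ.* (I ℕ.* N)               ≡⟨ square-* I N ⟩
    (I ℕ.* I) ℕ.* (N ℕ.* N)               ≤⟨ ℕP.*-monoˡ-≤ (N ℕ.* N) (isqrt-lower (a ℕ.* (M ℕ.* M))) ⟩
    (a ℕ.* (M ℕ.* M)) ℕ.* (N ℕ.* N)       ≡⟨ ℕP.*-assoc a (M ℕ.* M) (N ℕ.* N) ⟩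
    a ℕ.* ((M ℕ.* M) ℕ.* (N ℕ.* N))       ≡⟨ cong (a ℕ.*_) (ℕP.*-comm (M ℕ.* M) (N ℕ.* N)) ⟩
    a ℕ.* ((N ℕ.* N) ℕ.* (M ℕ.* M))       ≡⟨ ℕP.*-assoc a (N ℕ.* N) (M ℕ.* M) ⟨
    (a ℕ.* (N ℕ.* N)) ℕ.* (M ℕ.* M)       <⟨ ℕP.*-monoˡ-< (M ℕ.* M) (isqrt-upper (a ℕ.* (N ℕ.* N))) ⟩
    (J ℕ.* J) ℕ.* (M ℕ.* M)               ≡⟨ square-* J M ⟨
    (J ℕ.* M) ℕ.* (J ℕ.* M)               ∎
    where open ℕP.≤-Reasoning
  cross : I ℕ.* N ℕ.≤ J ℕ.* M
  cross with ℕP.≤-total (I ℕ.* N) (J ℕ.* M)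
  ... | inj₁ le = le
  ... | inj₂ ge = ℕP.<⇒≤ (ℕP.≰⇒> λ _ → ℕP.<⇒≱ squares (ℕP.*-mono-≤ ge ge))

√ : ℕ → ℝ
√ a = mkℝ (sqrtApprox a) λ ε 0<ε →
  let N , small = invSuc-small 1ℚ ε (<⇒≤ 0<1) 0<ε
      inv≤ε = λ n n≥ → subst (_≤ ε) (*-identityˡ (invSuc n)) (small n n≥)
  in N , λ m n m≥ n≥ → abs-≤ (sqrtApprox a m) (sqrtApprox a n)
       (≤-trans (minus (sqrtApprox a m) (sqrtApprox a n) (sqrtApprox-≤ a m n)) (inv≤ε n n≥))
       (≤-trans (minus (sqrtApprox a n) (sqrtApprox a m) (sqrtApprox-≤ a n m)) (inv≤ε m m≥))
  where
  open +-*-Solver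
  minus : ∀ p q {r} → p ≤ q + r → p - q ≤ r
  minus p q {r} p≤q+r = subst (p - q ≤_)
    (solve 2 (λ q r → q :+ r :- q := r) refl q r) (+-monoˡ-≤ (- q) p≤q+r)
  abs-≤ : ∀ p q {ε} → p - q ≤ ε → q - p ≤ ε → ∣ p - q ∣ ≤ ε
  abs-≤ p q {ε} pq qp with ∣p∣≡p∨∣p∣≡-p (p - q)
  ... | inj₁ eq = subst (_≤ ε) (sym eq) pq
  ... | inj₂ eq = subst (_≤ ε) (sym (trans eq
                    (solve 2 (λ p q → :- (p :- q) := q :- p) refl p q))) qp

√-square : ∀ a → √ a *ℝ √ a ≃ fromℚ (fromℕ a)
√-square a ε 0<ε = go (eventuallyBounded (√ a))
  where
  open ≤-Reasoning
  open +-*-Solver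
  s = sqrtApprox a
  i = invSuc
  A = fromℕ a
  i≤1 : ∀ n → i n ≤ 1ℚ
  i≤1 n = subst₂ _≤_ (*-identityˡ (i n)) (fromℕ*invSuc n)
    (*-monoʳ-≤-nonNeg (i n) {{nonNegative (<⇒≤ (0<invSuc n))}} (fromℕ-mono {1} {suc n} (ℕ.s≤s ℕ.z≤n)))
  square : ∀ j n → fromℕ (j ℕ.* j) * (i n * i n) ≡ (fromℕ j * i n) * (fromℕ j * i n)
  square j n = trans (cong (_* (i n * i n)) (fromℕ-* j j))
    (solve 2 (λ j i → j :* j :* (i :* i) := j :* i :* (j :* i)) refl (fromℕ j) (i n))
  clear : ∀ n → fromℕ (a ℕ.* (suc n ℕ.* suc n)) * (i n * i n) ≡ A
  clear n = trans (cong (_* (i n * i n)) (fromℕ-* a (suc n ℕ.* suc n)))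
    (trans (*-assoc A _ _)
    (trans (cong (A *_) (trans (square (suc n) n) (cong (λ z → z * z) (fromℕ*invSuc n))))
    (*-identityʳ A)))
  0≤ii : ∀ n → 0ℚ ≤ i n * i n
  0≤ii n = <⇒≤ (*-pos (0<invSuc n) (0<invSuc n))
  lower : ∀ n → s n * s n ≤ A
  lower n = subst₂ _≤_ (square (sqrtNum a n) n) (clear n)
    (*-monoʳ-≤-nonNeg (i n * i n) {{nonNegative (0≤ii n)}} (fromℕ-mono (isqrt-lower (a ℕ.* (suc n ℕ.* suc n)))))
  upper : ∀ n → A ≤ (s n + i n) * (s n + i n)
  upper n = subst₂ _≤_ (clear n)
    (trans (square (suc (sqrtNum a n)) n) (cong (λ z → z * z)
      (trans (cong (_* i n) (fromℕ-suc (sqrtNum a n)))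
        (solve 2 (λ k i → (k :+ con 1ℚ) :* i := k :* i :+ i) refl (fromℕ (sqrtNum a n)) (i n)))))
    (*-monoʳ-≤-nonNeg (i n * i n) {{nonNegative (0≤ii n)}} (fromℕ-mono (ℕP.<⇒≤ (isqrt-upper (a ℕ.* (suc n ℕ.* suc n))))))
  go : ∃[ b ] 0ℚ < b × (∃[ M ] ∀ n → M ℕ.≤ n → ∣ s n ∣ ≤ b) →
       ∃[ N ] ∀ n → N ℕ.≤ n → ∣ s n * s n - A ∣ ≤ ε
  go (b , 0<b , M , √≤b) =
    let N , small = invSuc-small (2ℚ * b + 1ℚ) ε
          (<⇒≤ (<-≤-trans 0<1 (subst (1ℚ ≤_) (+-comm 1ℚ (2ℚ * b))
            (p≤p+nonNeg 1ℚ (*-nonNeg (<⇒≤ (positive⁻¹ 2ℚ)) (<⇒≤ 0<b)))))) 0<ε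
    in M ℕ.⊔ N , λ n n≥ → begin
      ∣ s n * s n - A ∣      ≡⟨ ∣p-q∣≡∣q-p∣ (s n * s n) A ⟩
      ∣ A - s n * s n ∣      ≡⟨ 0≤p⇒∣p∣≡p (subst (_≤ A - s n * s n) (+-inverseʳ (s n * s n)) (+-monoˡ-≤ (- (s n * s n)) (lower n))) ⟩
      A - s n * s n          ≤⟨ +-monoˡ-≤ (- (s n * s n)) (upper n) ⟩
      (s n + i n) * (s n + i n) - s n * s n
                             ≡⟨ solve 2 (λ s i → (s :+ i) :* (s :+ i) :- s :* s := (con 2ℚ :* s :+ i) :* i) refl (s n) (i n) ⟩
      (2ℚ * s n + i n) * i n ≤⟨ *-monoʳ-≤-nonNeg (i n) {{nonNegative (<⇒≤ (0<invSuc n))}}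
                                  (+-mono-≤ (*-monoˡ-≤-nonNeg 2ℚ (≤-trans (p≤∣p∣ (s n)) (√≤b n (ℕP.m⊔n≤o⇒m≤o M N n≥)))) (i≤1 n)) ⟩
      (2ℚ * b + 1ℚ) * i n    ≤⟨ small n (ℕP.m⊔n≤o⇒n≤o M N n≥) ⟩
      ε                      ∎

φ : ℝ
φ = fromℚ ½ *ℝ (1ℝ +ℝ √ 5)

φ-pos : 0ℝ <ℝ φ
φ-pos = ½ , 0<½ , 0 , λ n _ →
  *-monoˡ-≤-nonNeg ½ (p≤p+nonNeg 1ℚ (0≤sqrtApprox 5 n))

lucas : ℕ → ℕ
lucas zero          = 2
lucas (suc zero)    = 1
lucas (suc (suc m)) = lucas (suc m) ℕ.+ lucas m

-- With n = 2k + 1 odd, P = φⁿ satisfies P² = Lₙ P + 1. Hence α = arctan (1/P) has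
-- tan 2α = 2/Lₙ, and β = arctan ((Lₙ - 2)/(Lₙ + 2)) has tan β = tan (π/4 - 2α),
-- which gives sin (2α + β - π/4) = 0. Since 0 ≤ α ≤ π/4, the argument lies in
-- (-π, π), where sin vanishes only at 0. The addition formulas come from the Cauchy
-- product of the power series, and sin t > 0 on (0, π) from
-- sin t = 2 sin (t/2) cos (t/2), with cos > 0 below π/2, repeated until t is small.
-- Real equality is stable under double negation, so signs may be argued by cases.
module Submission where

open import Defs
open import Data.Product using (_×_; _,_; proj₁; proj₂; ∃-syntax)
open import Data.Sum using (_⊎_; inj₁; inj₂)
open import Function using (_∘_)
open import Relation.Nullary using (¬_; yes; no; contradiction)
open import Relation.Binary.PropositionalEquality

-- The order on these reals is not decidable, so 0 ≤ α ≤ π/4 is available only as two negations,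
-- while positivity of the sine on (0, π) asks for strict bounds with a rational margin. Slack
-- closes this gap: with α in that range and β strictly between -π/2 and π/2, the angle 2α + β - π/4
-- stays π/4 away from both ends of (-π, π). Since a positive sum has a positive summand,
-- constructively, refuting one summand leaves the strict bound on the other.
--
-- Sines are compared instead of tangents because nothing guarantees beforehand that cos 2α or cos
-- (2α + β) is nonzero. For the same reason the identities are polynomial: a quotient is replaced by
-- an equation multiplied out, and a nonzero factor is cancelled only when it is known to be
-- positive.
--
-- The n-th approximation of sin x is a partial sum at the n-th approximation of x. Oddness
-- therefore holds index by index, whereas an addition formula needs an estimate: a product of
-- partial sums runs over a square of index pairs, a partial sum at x + y over a triangle.

module Analysis where

  open import Data.Nat as ℕ using (ℕ; zero; suc)
  import Data.Nat.Properties as ℕP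
  open import Data.Integer as ℤ using (+_)
  import Data.Integer.Properties as ℤP
  open import Data.Rational hiding (_≃_)
  open import Data.Rational.Properties
  open import Data.Rational.Unnormalised as ℚᵘ using (mkℚᵘ; *≡*)
  import Data.Rational.Unnormalised.Properties as ℚᵘP
  open import Data.Rational.Solver using (module +-*-Solver)
  open +-*-Solver

  -- Cauchy products of rational sequences

  Σ< : (ℕ → ℚ) → ℕ → ℚ
  Σ< a zero    = 0ℚ
  Σ< a (suc n) = Σ< a n + a n

  conv : (ℕ → ℚ) → (ℕ → ℚ) → ℕ → ℚ
  conv a b zero    = a 0 * b 0
  conv a b (suc n) = a 0 * b (suc n) + conv (a ∘ suc) b n

  -- The sum of a i * b j over i + j < n.
  triangle : (ℕ → ℚ) → (ℕ → ℚ) → ℕ → ℚ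
  triangle a b = Σ< (conv a b)

  Σ<-cong : ∀ {a a′} → (∀ i → a i ≡ a′ i) → ∀ n → Σ< a n ≡ Σ< a′ n
  Σ<-cong a≡ zero    = refl
  Σ<-cong a≡ (suc n) = cong₂ _+_ (Σ<-cong a≡ n) (a≡ n)

  Σ<-+ : ∀ a b n → Σ< (λ i → a i + b i) n ≡ Σ< a n + Σ< b n
  Σ<-+ a b zero    = refl
  Σ<-+ a b (suc n) = trans (cong (_+ (a n + b n)) (Σ<-+ a b n))
    (solve 4 (λ s t x y → s :+ t :+ (x :+ y) := s :+ x :+ (t :+ y)) refl (Σ< a n) (Σ< b n) (a n) (b n))

  Σ<-- : ∀ a b n → Σ< (λ i → a i - b i) n ≡ Σ< a n - Σ< b n
  Σ<-- a b zero    = refl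
  Σ<-- a b (suc n) = trans (cong (_+ (a n - b n)) (Σ<-- a b n))
    (solve 4 (λ s t x y → s :- t :+ (x :- y) := s :+ x :- (t :+ y)) refl (Σ< a n) (Σ< b n) (a n) (b n))

  Σ<-head : ∀ a n → Σ< a (suc n) ≡ a 0 + Σ< (a ∘ suc) n
  Σ<-head a zero    = +-comm 0ℚ (a 0)
  Σ<-head a (suc n) = trans (cong (_+ a (suc n)) (Σ<-head a n)) (+-assoc (a 0) _ (a (suc n)))

  Σ<-mono : ∀ {a} → (∀ i → 0ℚ ≤ a i) → ∀ k n → Σ< a n ≤ Σ< a (k ℕ.+ n)
  Σ<-mono 0≤a zero    n = ≤-refl
  Σ<-mono 0≤a (suc k) n = ≤-trans (Σ<-mono 0≤a k n) (p≤p+nonNeg _ (0≤a (k ℕ.+ n)))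

  Σ<-nonNeg : ∀ {a} → (∀ i → 0ℚ ≤ a i) → ∀ n → 0ℚ ≤ Σ< a n
  Σ<-nonNeg 0≤a n = subst (λ k → 0ℚ ≤ Σ< _ k) (ℕP.+-identityʳ n) (Σ<-mono 0≤a n 0)

  Σ<-tail : ∀ {a A} → (∀ i → ∣ a i ∣ ≤ A i) → ∀ k n →
    ∣ Σ< a (k ℕ.+ n) - Σ< a n ∣ ≤ Σ< A (k ℕ.+ n) - Σ< A n
  Σ<-tail {a} {A} a≤A zero n = ≤-reflexive
    (trans (cong ∣_∣ (+-inverseʳ (Σ< a n))) (sym (+-inverseʳ (Σ< A n))))
  Σ<-tail {a} {A} a≤A (suc k) n = subst₂ _≤_
    (cong ∣_∣ (solve 3 (λ u v w → (u :- v) :+ w := u :+ w :- v) refl (Σ< a (k ℕ.+ n)) (Σ< a n) (a (k ℕ.+ n))))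
    (solve 3 (λ u v w → (u :- v) :+ w := u :+ w :- v) refl (Σ< A (k ℕ.+ n)) (Σ< A n) (A (k ℕ.+ n)))
    (∣+∣-mono {Σ< a (k ℕ.+ n) - Σ< a n} (Σ<-tail a≤A k n) (a≤A (k ℕ.+ n)))

  -- Row i = 0 of the triangle is split off; the remaining rows form the triangle of the shifted
  -- sequence, one size smaller.
  triangle-suc : ∀ a b n → triangle a b (suc n) ≡ a 0 * Σ< b (suc n) + triangle (a ∘ suc) b n
  triangle-suc a b zero = solve 2 (λ x y → con 0ℚ :+ x :* y := x :* (con 0ℚ :+ y) :+ con 0ℚ) refl (a 0) (b 0)
  triangle-suc a b (suc n) = trans (cong (_+ conv a b (suc n)) (triangle-suc a b n))
    (solve 5 (λ x s y t c → x :* s :+ t :+ (x :* y :+ c) := x :* (s :+ y) :+ (t :+ c)) refl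
      (a 0) (Σ< b (suc n)) (b (suc n)) (triangle (a ∘ suc) b n) (conv (a ∘ suc) b n))

  -- Inside the bars stands the sum over the pairs of the rectangle that lie outside the triangle,
  -- so the majorants bound it term by term. The second factor has the longer range k + m because
  -- removing row i = 0 shrinks the triangle but leaves the range of j alone: k grows while m drops.
  product-triangle : ∀ {a b A B} → (∀ i → ∣ a i ∣ ≤ A i) → (∀ j → ∣ b j ∣ ≤ B j) → ∀ k m →
    ∣ Σ< a m * Σ< b (k ℕ.+ m) - triangle a b m ∣ ≤ Σ< A m * Σ< B (k ℕ.+ m) - triangle A B m
  product-triangle {a} {b} {A} {B} a≤A b≤B k zero = ≤-reflexive (trans
    (cong ∣_∣ (solve 1 (λ s → con 0ℚ :* s :- con 0ℚ := con 0ℚ) refl (Σ< b (k ℕ.+ 0))))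
    (solve 1 (λ s → con 0ℚ := con 0ℚ :* s :- con 0ℚ) refl (Σ< B (k ℕ.+ 0))))
  product-triangle {a} {b} {A} {B} a≤A b≤B k (suc m) = subst₂ _≤_
    (cong ∣_∣ (split a b)) (split A B)
    (∣+∣-mono {a 0 * (Σ< b (k ℕ.+ suc m) - Σ< b (suc m))}
      (∣*∣-mono {a 0} (a≤A 0) (Σ<-tail b≤B k (suc m)))
      (subst (λ n → ∣ Σ< (a ∘ suc) m * Σ< b n - triangle (a ∘ suc) b m ∣
                    ≤ Σ< (A ∘ suc) m * Σ< B n - triangle (A ∘ suc) B m)
        (sym (ℕP.+-suc k m))
        (product-triangle (a≤A ∘ suc) b≤B (suc k) m)))
    where
    split : ∀ a b → a 0 * (Σ< b (k ℕ.+ suc m) - Σ< b (suc m))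
                    + (Σ< (a ∘ suc) m * Σ< b (k ℕ.+ suc m) - triangle (a ∘ suc) b m)
                  ≡ Σ< a (suc m) * Σ< b (k ℕ.+ suc m) - triangle a b (suc m)
    split a b = trans
      (solve 5 (λ x u v s t → x :* (u :- v) :+ (s :* u :- t) := (x :+ s) :* u :- (x :* v :+ t)) refl
        (a 0) (Σ< b (k ℕ.+ suc m)) (Σ< b (suc m)) (Σ< (a ∘ suc) m) (triangle (a ∘ suc) b m))
      (sym (cong₂ (λ s t → s * Σ< b (k ℕ.+ suc m) - t) (Σ<-head a m) (triangle-suc a b m)))

  conv-nonNeg : ∀ {a b} → (∀ i → 0ℚ ≤ a i) → (∀ j → 0ℚ ≤ b j) → ∀ n → 0ℚ ≤ conv a b n
  conv-nonNeg 0≤a 0≤b zero    = *-nonNeg (0≤a 0) (0≤b 0)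
  conv-nonNeg 0≤a 0≤b (suc n) =
    +-mono-≤ (*-nonNeg (0≤a 0) (0≤b (suc n))) (conv-nonNeg (0≤a ∘ suc) 0≤b n)

  -- The rectangle i < m, j < n is contained in the triangle i + j < m + n, and no term is negative.
  product≤triangle : ∀ {a b} → (∀ i → 0ℚ ≤ a i) → (∀ j → 0ℚ ≤ b j) → ∀ m n →
    Σ< a m * Σ< b n ≤ triangle a b (m ℕ.+ n)
  product≤triangle {a} {b} 0≤a 0≤b zero n = subst (_≤ triangle a b n) (sym (*-zeroˡ (Σ< b n)))
    (Σ<-nonNeg (conv-nonNeg 0≤a 0≤b) n)
  product≤triangle {a} {b} 0≤a 0≤b (suc m) n = begin
    Σ< a (suc m) * Σ< b n                       ≡⟨ cong (_* Σ< b n) (Σ<-head a m) ⟩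
    (a 0 + Σ< (a ∘ suc) m) * Σ< b n             ≡⟨ *-distribʳ-+ (Σ< b n) (a 0) _ ⟩
    a 0 * Σ< b n + Σ< (a ∘ suc) m * Σ< b n      ≤⟨ +-mono-≤
                                                     (*-monoˡ-≤-nonNeg (a 0) {{nonNegative (0≤a 0)}} (Σ<-mono 0≤b (suc m) n))
                                                     (product≤triangle (0≤a ∘ suc) 0≤b m n) ⟩
    a 0 * Σ< b (suc (m ℕ.+ n)) + triangle (a ∘ suc) b (m ℕ.+ n)
                                                ≡⟨ triangle-suc a b (m ℕ.+ n) ⟨
    triangle a b (suc m ℕ.+ n)                  ∎
    where open ≤-Reasoning

  conv-cong : ∀ {a a′ b b′} → (∀ i → a i ≡ a′ i) → (∀ j → b j ≡ b′ j) → ∀ n → conv a b n ≡ conv a′ b′ n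
  conv-cong a≡ b≡ zero    = cong₂ _*_ (a≡ 0) (b≡ 0)
  conv-cong a≡ b≡ (suc n) =
    cong₂ _+_ (cong₂ _*_ (a≡ 0) (b≡ (suc n))) (conv-cong (a≡ ∘ suc) b≡ n)

  conv-+ˡ : ∀ a a′ b n → conv (λ i → a i + a′ i) b n ≡ conv a b n + conv a′ b n
  conv-+ˡ a a′ b zero    = *-distribʳ-+ (b 0) (a 0) (a′ 0)
  conv-+ˡ a a′ b (suc n) = trans
    (cong (λ z → (a 0 + a′ 0) * b (suc n) + z) (conv-+ˡ (a ∘ suc) (a′ ∘ suc) b n))
    (solve 5 (λ x y z u v → (x :+ y) :* z :+ (u :+ v) := x :* z :+ u :+ (y :* z :+ v)) refl
      (a 0) (a′ 0) (b (suc n)) (conv (a ∘ suc) b n) (conv (a′ ∘ suc) b n))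

  conv-scaleˡ : ∀ a b c n → conv (λ i → a i * c) b n ≡ conv a b n * c
  conv-scaleˡ a b c zero    = solve 3 (λ x y z → x :* z :* y := x :* y :* z) refl (a 0) (b 0) c
  conv-scaleˡ a b c (suc n) = trans (cong (λ z → a 0 * c * b (suc n) + z) (conv-scaleˡ (a ∘ suc) b c n))
    (solve 4 (λ x y z u → x :* z :* y :+ u :* z := (x :* y :+ u) :* z) refl
      (a 0) (b (suc n)) c (conv (a ∘ suc) b n))

  conv-scaleʳ : ∀ a b c n → conv a (λ j → b j * c) n ≡ conv a b n * c
  conv-scaleʳ a b c zero    = sym (*-assoc (a 0) (b 0) c)
  conv-scaleʳ a b c (suc n) = trans (cong (λ z → a 0 * (b (suc n) * c) + z) (conv-scaleʳ (a ∘ suc) b c n))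
    (solve 4 (λ x y z u → x :* (y :* z) :+ u :* z := (x :* y :+ u) :* z) refl
      (a 0) (b (suc n)) c (conv (a ∘ suc) b n))

  -- The coefficients of the formal derivative of the power series with coefficients a.
  derivative : (ℕ → ℚ) → ℕ → ℚ
  derivative a i = fromℕ (suc i) * a (suc i)

  -- The product rule for formal power series, read off at the coefficient of degree n.
  leibniz : ∀ a b n → fromℕ (suc n) * conv a b (suc n) ≡ conv (derivative a) b n + conv a (derivative b) n
  leibniz a b zero = solve 4 (λ x y z w → con 1ℚ :* (x :* w :+ y :* z) := con 1ℚ :* y :* z :+ x :* (con 1ℚ :* w)) refl
    (a 0) (a 1) (b 0) (b 1)
  leibniz a b (suc n) = begin
    N * (a 0 * b (2 ℕ.+ n) + conv a′ b (suc n))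
      ≡⟨ *-distribˡ-+ N _ _ ⟩
    N * (a 0 * b (2 ℕ.+ n)) + N * conv a′ b (suc n)
      -- Of the factor n + 2, the part n + 1 feeds the induction hypothesis for the shifted
      -- sequence; the remaining 1 turns the derivative of the shift into the shift of the
      -- derivative.
      ≡⟨ cong (λ z → N * (a 0 * b (2 ℕ.+ n)) + z * conv a′ b (suc n)) (fromℕ-suc (suc n)) ⟩
    N * (a 0 * b (2 ℕ.+ n)) + (M + 1ℚ) * conv a′ b (suc n)
      ≡⟨ cong (λ z → N * (a 0 * b (2 ℕ.+ n)) + z) (trans (*-distribʳ-+ (conv a′ b (suc n)) M 1ℚ)
           (cong₂ _+_ (leibniz a′ b n) (*-identityˡ _))) ⟩
    N * (a 0 * b (2 ℕ.+ n)) + (conv (derivative a′) b n + conv a′ (derivative b) n + (a 1 * b (suc n) + conv (a′ ∘ suc) b n))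
      ≡⟨ solve 8 (λ N x y p q u v w → N :* (x :* y) :+ (p :+ q :+ (u :* v :+ w)) := con 1ℚ :* u :* v :+ (p :+ w) :+ (x :* (N :* y) :+ q)) refl
           N (a 0) (b (2 ℕ.+ n)) (conv (derivative a′) b n) (conv a′ (derivative b) n) (a 1) (b (suc n)) (conv (a′ ∘ suc) b n) ⟩
    1ℚ * a 1 * b (suc n) + (conv (derivative a′) b n + conv (a′ ∘ suc) b n) + (a 0 * (N * b (2 ℕ.+ n)) + conv a′ (derivative b) n)
      ≡⟨ cong (λ z → 1ℚ * a 1 * b (suc n) + z + (a 0 * (N * b (2 ℕ.+ n)) + conv a′ (derivative b) n))
           (trans (sym (conv-+ˡ (derivative a′) (a′ ∘ suc) b n)) (conv-cong shift (λ _ → refl) n)) ⟩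
    conv (derivative a) b (suc n) + conv a (derivative b) (suc n) ∎
    where
    open ≡-Reasoning
    a′ = a ∘ suc
    N = fromℕ (2 ℕ.+ n)
    M = fromℕ (suc n)
    shift : ∀ i → derivative a′ i + a′ (suc i) ≡ derivative a (suc i)
    shift i = trans (solve 2 (λ m x → m :* x :+ x := (m :+ con 1ℚ) :* x) refl (fromℕ (suc i)) (a (2 ℕ.+ i)))
      (cong (_* a (2 ℕ.+ i)) (sym (fromℕ-suc (suc i))))

  -- Addition formulas for the partial sums of sin and cos

  fromℕ-suc-cancel : ∀ n {p q} → fromℕ (suc n) * p ≡ fromℕ (suc n) * q → p ≡ q
  fromℕ-suc-cancel n {p} {q} eq = trans (sym (clear p)) (trans (cong (invSuc n *_) eq) (clear q))
    where
    clear : ∀ r → invSuc n * (fromℕ (suc n) * r) ≡ r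
    clear r = trans (solve 3 (λ i m r → i :* (m :* r) := m :* i :* r) refl (invSuc n) (fromℕ (suc n)) r)
      (trans (cong (_* r) (fromℕ*invSuc n)) (*-identityˡ r))

  -- The series of exp (pt) is determined by f′ = pf and f(0) = 1. By `leibniz` the product of two
  -- such series satisfies the equation for p + q, so no binomial coefficients are needed.
  binomial : ∀ p q n → conv (powOverFact p) (powOverFact q) n ≡ powOverFact (p + q) n
  binomial p q zero    = refl
  binomial p q (suc n) = fromℕ-suc-cancel n (begin
    fromℕ (suc n) * conv P Q (suc n)
      ≡⟨ leibniz P Q n ⟩
    conv (derivative P) Q n + conv P (derivative Q) n
      ≡⟨ cong₂ _+_ (conv-cong (powOverFact-suc p) (λ _ → refl) n) (conv-cong (λ _ → refl) (powOverFact-suc q) n) ⟩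
    conv (λ i → P i * p) Q n + conv P (λ j → Q j * q) n
      ≡⟨ cong₂ _+_ (conv-scaleˡ P Q p n) (conv-scaleʳ P Q q n) ⟩
    conv P Q n * p + conv P Q n * q
      ≡⟨ *-distribˡ-+ (conv P Q n) p q ⟨
    conv P Q n * (p + q)
      ≡⟨ cong (_* (p + q)) (binomial p q n) ⟩
    powOverFact (p + q) n * (p + q)
      ≡⟨ powOverFact-suc (p + q) n ⟨
    fromℕ (suc n) * powOverFact (p + q) (suc n) ∎)
    where
    open ≡-Reasoning
    P = powOverFact p
    Q = powOverFact q

  sinSign-suc : ∀ n → sinSign (suc n) ≡ cosSign n
  sinSign-suc zero          = refl
  sinSign-suc (suc zero)    = refl
  sinSign-suc (suc (suc n)) = cong -_ (sinSign-suc n)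

  cosSign-suc : ∀ n → cosSign (suc n) ≡ - sinSign n
  cosSign-suc zero          = refl
  cosSign-suc (suc zero)    = refl
  cosSign-suc (suc (suc n)) = cong -_ (cosSign-suc n)

  infixr 8 _⊙_
  _⊙_ : (ℕ → ℚ) → (ℕ → ℚ) → ℕ → ℚ
  (s ⊙ a) i = s i * a i

  conv-sin-shift : ∀ u w n → conv ((sinSign ⊙ u) ∘ suc) w n ≡ conv (cosSign ⊙ (u ∘ suc)) w n
  conv-sin-shift u w = conv-cong (λ i → cong (_* u (suc i)) (sinSign-suc i)) (λ _ → refl)

  conv-cos-shift : ∀ u w n → conv ((cosSign ⊙ u) ∘ suc) w n ≡ conv (sinSign ⊙ (u ∘ suc)) w n * - 1ℚ
  conv-cos-shift u w n = trans
    (conv-cong (λ i → trans (cong (_* u (suc i)) (cosSign-suc i))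
      (solve 2 (λ s x → (:- s) :* x := s :* x :* con (- 1ℚ)) refl (sinSign i) (u (suc i)))) (λ _ → refl) n)
    (conv-scaleˡ (sinSign ⊙ (u ∘ suc)) w (- 1ℚ) n)

  -- `cosSign` and `sinSign` are the real and imaginary parts of the powers of the imaginary unit,
  -- so this and `cos-conv` express that exponents add. The two are proved together because shifting
  -- u turns sine signs into cosine signs and cosine signs into negated sine signs; u and v are
  -- arbitrary to allow that shift.
  sin-conv : ∀ u v n → conv (sinSign ⊙ u) (cosSign ⊙ v) n + conv (cosSign ⊙ u) (sinSign ⊙ v) n
                     ≡ sinSign n * conv u v n
  cos-conv : ∀ u v n → conv (cosSign ⊙ u) (cosSign ⊙ v) n - conv (sinSign ⊙ u) (sinSign ⊙ v) n
                     ≡ cosSign n * conv u v n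
  sin-conv u v zero = solve 2 (λ x y → con 0ℚ :* x :* (con 1ℚ :* y) :+ con 1ℚ :* x :* (con 0ℚ :* y) := con 0ℚ :* (x :* y)) refl (u 0) (v 0)
  sin-conv u v (suc n) = begin
    0ℚ * u 0 * (c * y) + conv ((sinSign ⊙ u) ∘ suc) (cosSign ⊙ v) n
      + (1ℚ * u 0 * (s * y) + conv ((cosSign ⊙ u) ∘ suc) (sinSign ⊙ v) n)
      ≡⟨ cong₂ (λ p q → 0ℚ * u 0 * (c * y) + p + (1ℚ * u 0 * (s * y) + q))
           (conv-sin-shift u (cosSign ⊙ v) n) (conv-cos-shift u (sinSign ⊙ v) n) ⟩
    0ℚ * u 0 * (c * y) + A + (1ℚ * u 0 * (s * y) + B * - 1ℚ)
      ≡⟨ solve 6 (λ x c y s A B → con 0ℚ :* x :* (c :* y) :+ A :+ (con 1ℚ :* x :* (s :* y) :+ B :* con (- 1ℚ))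
           := s :* (x :* y) :+ (A :- B)) refl (u 0) c y s A B ⟩
    s * (u 0 * y) + (A - B)
      ≡⟨ cong (λ z → s * (u 0 * y) + z) (trans (cos-conv (u ∘ suc) v n) (cong (_* conv (u ∘ suc) v n) (sym (sinSign-suc n)))) ⟩
    s * (u 0 * y) + s * conv (u ∘ suc) v n
      ≡⟨ *-distribˡ-+ s _ _ ⟨
    s * conv u v (suc n) ∎
    where
    open ≡-Reasoning
    s = sinSign (suc n)
    c = cosSign (suc n)
    y = v (suc n)
    A = conv (cosSign ⊙ (u ∘ suc)) (cosSign ⊙ v) n
    B = conv (sinSign ⊙ (u ∘ suc)) (sinSign ⊙ v) n
  cos-conv u v zero = solve 2 (λ x y → con 1ℚ :* x :* (con 1ℚ :* y) :- con 0ℚ :* x :* (con 0ℚ :* y) := con 1ℚ :* (x :* y)) refl (u 0) (v 0)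
  cos-conv u v (suc n) = begin
    1ℚ * u 0 * (c * y) + conv ((cosSign ⊙ u) ∘ suc) (cosSign ⊙ v) n
      - (0ℚ * u 0 * (s * y) + conv ((sinSign ⊙ u) ∘ suc) (sinSign ⊙ v) n)
      ≡⟨ cong₂ (λ p q → 1ℚ * u 0 * (c * y) + p - (0ℚ * u 0 * (s * y) + q))
           (conv-cos-shift u (cosSign ⊙ v) n) (conv-sin-shift u (sinSign ⊙ v) n) ⟩
    1ℚ * u 0 * (c * y) + A * - 1ℚ - (0ℚ * u 0 * (s * y) + B)
      ≡⟨ solve 6 (λ x c y s A B → con 1ℚ :* x :* (c :* y) :+ A :* con (- 1ℚ) :- (con 0ℚ :* x :* (s :* y) :+ B)
           := c :* (x :* y) :- (A :+ B)) refl (u 0) c y s A B ⟩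
    c * (u 0 * y) - (A + B)
      ≡⟨ cong (λ z → c * (u 0 * y) - z) (sin-conv (u ∘ suc) v n) ⟩
    c * (u 0 * y) - sinSign n * conv (u ∘ suc) v n
      ≡⟨ solve 3 (λ p s w → p :- s :* w := p :+ (:- s) :* w) refl (c * (u 0 * y)) (sinSign n) (conv (u ∘ suc) v n) ⟩
    c * (u 0 * y) + (- sinSign n) * conv (u ∘ suc) v n
      ≡⟨ cong (λ z → c * (u 0 * y) + z * conv (u ∘ suc) v n) (sym (cosSign-suc n)) ⟩
    c * (u 0 * y) + c * conv (u ∘ suc) v n
      ≡⟨ *-distribˡ-+ c _ _ ⟨
    c * conv u v (suc n) ∎
    where
    open ≡-Reasoning
    s = sinSign (suc n)
    c = cosSign (suc n)
    y = v (suc n)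
    A = conv (sinSign ⊙ (u ∘ suc)) (cosSign ⊙ v) n
    B = conv (cosSign ⊙ (u ∘ suc)) (sinSign ⊙ v) n

  partialSum-Σ< : ∀ s x n → partialSum s x n ≡ Σ< (s ⊙ powOverFact x) n
  partialSum-Σ< s x zero    = refl
  partialSum-Σ< s x (suc n) = cong (_+ s n * powOverFact x n) (partialSum-Σ< s x n)

  expSum-Σ< : ∀ x n → expSum x n ≡ Σ< (powOverFact x) n
  expSum-Σ< x n = trans (partialSum-Σ< (λ _ → 1ℚ) x n) (Σ<-cong (λ i → *-identityˡ (powOverFact x i)) n)

  triangle-powOverFact : ∀ p q n → triangle (powOverFact p) (powOverFact q) n ≡ expSum (p + q) n
  triangle-powOverFact p q n = trans (Σ<-cong (binomial p q) n) (sym (expSum-Σ< (p + q) n))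

  -- The error is dominated by the one for the exponential series at b and d. There the square lies
  -- inside the triangle of size n + n, and by `binomial` both triangles are partial sums of exp (b
  -- + d), which leaves a piece of its tail.
  partialSum-product : ∀ {s t p q b d} → (∀ j → ∣ s j ∣ ≤ 1ℚ) → (∀ j → ∣ t j ∣ ≤ 1ℚ) → ∣ p ∣ ≤ b → ∣ q ∣ ≤ d → ∀ n →
    ∣ partialSum s p n * partialSum t q n - triangle (s ⊙ powOverFact p) (t ⊙ powOverFact q) n ∣
      ≤ expSum (b + d) (n ℕ.+ n) - expSum (b + d) n
  partialSum-product {s} {t} {p} {q} {b} {d} s≤1 t≤1 p≤b q≤d n = begin
    ∣ partialSum s p n * partialSum t q n - T ∣
      ≡⟨ cong₂ (λ u v → ∣ u * v - T ∣) (partialSum-Σ< s p n) (partialSum-Σ< t q n) ⟩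
    ∣ Σ< (s ⊙ powOverFact p) n * Σ< (t ⊙ powOverFact q) n - T ∣
      ≤⟨ product-triangle (dominated s≤1 p≤b) (dominated t≤1 q≤d) 0 n ⟩
    Σ< (powOverFact b) n * Σ< (powOverFact d) n - triangle (powOverFact b) (powOverFact d) n
      ≤⟨ +-monoˡ-≤ (- triangle (powOverFact b) (powOverFact d) n)
           (product≤triangle (powOverFact-nonNeg (≤-trans (0≤∣p∣ p) p≤b)) (powOverFact-nonNeg (≤-trans (0≤∣p∣ q) q≤d)) n n) ⟩
    triangle (powOverFact b) (powOverFact d) (n ℕ.+ n) - triangle (powOverFact b) (powOverFact d) n
      ≡⟨ cong₂ _-_ (triangle-powOverFact b d (n ℕ.+ n)) (triangle-powOverFact b d n) ⟩
    expSum (b + d) (n ℕ.+ n) - expSum (b + d) n ∎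
    where
    open ≤-Reasoning
    T = triangle (s ⊙ powOverFact p) (t ⊙ powOverFact q) n
    dominated : ∀ {s p b} → (∀ j → ∣ s j ∣ ≤ 1ℚ) → ∣ p ∣ ≤ b → ∀ j → ∣ (s ⊙ powOverFact p) j ∣ ≤ powOverFact b j
    dominated {s} {p} {b} s≤1 p≤b j = subst (∣ s j * powOverFact p j ∣ ≤_) (*-identityˡ (powOverFact b j))
      (∣*∣-mono {s j} (s≤1 j) (powOverFact-bound p≤b j))

  -- Over triangles the addition formula is exact at every finite length.
  sinSum-+ : ∀ p q n → partialSum sinSign (p + q) n
    ≡ triangle (sinSign ⊙ powOverFact p) (cosSign ⊙ powOverFact q) n
    + triangle (cosSign ⊙ powOverFact p) (sinSign ⊙ powOverFact q) n
  sinSum-+ p q n = trans (partialSum-Σ< sinSign (p + q) n)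
    (trans (Σ<-cong (λ i → trans (cong (sinSign i *_) (sym (binomial p q i)))
                                 (sym (sin-conv (powOverFact p) (powOverFact q) i))) n)
      (Σ<-+ _ _ n))

  cosSum-+ : ∀ p q n → partialSum cosSign (p + q) n
    ≡ triangle (cosSign ⊙ powOverFact p) (cosSign ⊙ powOverFact q) n
    - triangle (sinSign ⊙ powOverFact p) (sinSign ⊙ powOverFact q) n
  cosSum-+ p q n = trans (partialSum-Σ< cosSign (p + q) n)
    (trans (Σ<-cong (λ i → trans (cong (cosSign i *_) (sym (binomial p q i)))
                                 (sym (cos-conv (powOverFact p) (powOverFact q) i))) n)
      (Σ<-- _ _ n))

  -- Equality and positivity of reals

  -- Reduces an inequality to a known one with the same difference of sides, an equation fit for the
  -- ring solver.
  ≤-by : ∀ {p q r s} → p ≤ q → s - r ≡ q - p → r ≤ s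
  ≤-by {p} {q} {r} {s} p≤q eq = subst₂ _≤_
    (solve 2 (λ p r → p :+ (r :- p) := r) refl p r)
    (trans (solve 3 (λ p q r → q :+ (r :- p) := (q :- p) :+ r) refl p q r)
      (trans (cong (_+ r) (sym eq)) (solve 2 (λ r s → (s :- r) :+ r := s) refl r s)))
    (+-monoˡ-≤ (r - p) p≤q)

  ∣∣≤⇒-≤ : ∀ {p ε} → ∣ p ∣ ≤ ε → - p ≤ ε
  ∣∣≤⇒-≤ {p} {ε} p≤ε = ≤-trans (p≤∣p∣ (- p)) (subst (_≤ ε) (sym (∣-p∣≡∣p∣ p)) p≤ε)

  ∣∣≤-intro : ∀ {p ε} → p ≤ ε → - p ≤ ε → ∣ p ∣ ≤ ε
  ∣∣≤-intro {p} p≤ε -p≤ε with ∣p∣≡p∨∣p∣≡-p p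
  ... | inj₁ eq = subst (_≤ _) (sym eq) p≤ε
  ... | inj₂ eq = subst (_≤ _) (sym eq) -p≤ε

  infixl 6 _-ℝ_
  _-ℝ_ : ℝ → ℝ → ℝ
  x -ℝ y = x +ℝ (-ℝ y)

  half : ℝ → ℝ
  half x = fromℚ ½ *ℝ x

  -- _≃_ and _<ℝ_ unfold to statements about sequences, from which the reals
  -- cannot be inferred; the records keep them visible to unification.
  infix 4 _≈_
  record _≈_ (x y : ℝ) : Set where
    constructor ≈-intro
    field ≈-elim : x ≃ y
  open _≈_ public

  record Null (x : ℝ) : Set where
    constructor null
    field small : ∀ ε → 0ℚ < ε → ∃[ N ] ∀ n → N ℕ.≤ n → ∣ seq x n ∣ ≤ ε

  record Pos (x : ℝ) : Set where
    constructor mkPos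
    field
      {margin} : ℚ
      margin>0 : 0ℚ < margin
      {start}  : ℕ
      margin≤  : ∀ n → start ℕ.≤ n → margin ≤ seq x n

  infixr 7 _·_
  infixl 6 _⊕_

  _·_ : ∀ c {x y} → x ≈ y → Null (c *ℝ (x -ℝ y))
  c · ≈-intro x≃y = null λ ε 0<ε →
    let b , 0<b , M , c≤b = eventuallyBounded c
        N , xy = x≃y (ε * invPos b 0<b) (*-pos 0<ε (invPos-pos b 0<b))
    in M ℕ.⊔ N , λ n n≥ → subst (∣ _ ∣ ≤_) (trans (*-comm b _) (scale-cancel ε b 0<b))
         (∣*∣-mono {seq c n} (c≤b n (ℕP.m⊔n≤o⇒m≤o M N n≥)) (xy n (ℕP.m⊔n≤o⇒n≤o M N n≥)))

  _⊕_ : ∀ {x y} → Null x → Null y → Null (x +ℝ y)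
  _⊕_ {x} (null xs) (null ys) = null λ ε 0<ε →
    let M , xM = xs (ε * ½) (*-pos 0<ε 0<½)
        N , yN = ys (ε * ½) (*-pos 0<ε 0<½)
    in M ℕ.⊔ N , λ n n≥ → subst (∣ _ ∣ ≤_) (half+half ε)
         (∣+∣-mono {seq x n} (xM n (ℕP.m⊔n≤o⇒m≤o M N n≥)) (yN n (ℕP.m⊔n≤o⇒n≤o M N n≥)))

  -- Real equations are proved by exhibiting the difference of the sides as a
  -- combination c₁ · e₁ ⊕ c₂ · e₂ ⊕ … of known equations, which the rational
  -- ring solver then checks at each index of the sequences.
  ≈-by : ∀ {x y z} → Null z → (∀ n → seq x n - seq y n ≡ seq z n) → x ≈ y
  ≈-by (null zs) eq = ≈-intro λ ε 0<ε →
    let N , zN = zs ε 0<ε in N , λ n n≥ → subst (_≤ ε) (cong ∣_∣ (sym (eq n))) (zN n n≥)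

  ≈-pointwise : ∀ {x y} → (∀ n → seq x n ≡ seq y n) → x ≈ y
  ≈-pointwise {x} {y} eq = ≈-intro λ ε 0<ε → 0 , λ n _ →
    subst (_≤ ε) (cong ∣_∣ (sym (trans (cong (_- seq y n) (eq n)) (+-inverseʳ (seq y n))))) (<⇒≤ 0<ε)

  ≈-sym : ∀ {x y} → x ≈ y → y ≈ x
  ≈-sym {x} {y} x≈y = ≈-by (fromℚ (- 1ℚ) · x≈y) λ n →
    solve 2 (λ x y → y :- x := con (- 1ℚ) :* (x :- y)) refl (seq x n) (seq y n)

  0<⇒Pos : ∀ {x} → 0ℝ <ℝ x → Pos x
  0<⇒Pos {x} (ε , 0<ε , N , ε≤x) = mkPos 0<ε λ n n≥ → subst (_≤ seq x n) (+-identityˡ ε) (ε≤x n n≥)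

  Pos⇒0< : ∀ {x} → Pos x → 0ℝ <ℝ x
  Pos⇒0< {x} (mkPos {ε} 0<ε {N} ε≤x) = ε , 0<ε , N , λ n n≥ → subst (_≤ seq x n) (sym (+-identityˡ ε)) (ε≤x n n≥)

  <⇒Pos : ∀ {x y} → x <ℝ y → Pos (y -ℝ x)
  <⇒Pos {x} {y} (ε , 0<ε , N , x<y) = mkPos 0<ε λ n n≥ → ≤-by (x<y n n≥)
    (solve 3 (λ x y e → y :- x :- e := y :- (x :+ e)) refl (seq x n) (seq y n) ε)

  Pos⇒< : ∀ {x y} → Pos (y -ℝ x) → x <ℝ y
  Pos⇒< {x} {y} (mkPos {ε} 0<ε {N} ε≤) = ε , 0<ε , N , λ n n≥ → ≤-by (ε≤ n n≥)
    (solve 3 (λ x y e → y :- (x :+ e) := y :- x :- e) refl (seq x n) (seq y n) ε)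

  Pos-mono : ∀ {x y} → (∀ n → seq x n ≤ seq y n) → Pos x → Pos y
  Pos-mono x≤y (mkPos 0<ε ε≤x) = mkPos 0<ε λ n n≥ → ≤-trans (ε≤x n n≥) (x≤y n)

  Pos-pointwise : ∀ {x y} → (∀ n → seq x n ≡ seq y n) → Pos x → Pos y
  Pos-pointwise eq = Pos-mono λ n → ≤-reflexive (eq n)

  Pos-fromℚ : ∀ {p} → 0ℚ < p → Pos (fromℚ p)
  Pos-fromℚ 0<p = mkPos 0<p {0} λ _ _ → ≤-refl

  Pos-+ : ∀ {x y} → Pos x → Pos y → Pos (x +ℝ y)
  Pos-+ (mkPos {ε} 0<ε {M} ε≤x) (mkPos {δ} 0<δ {N} δ≤y) = mkPos (+-mono-< 0<ε 0<δ) {M ℕ.⊔ N} λ n n≥ →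
    +-mono-≤ (ε≤x n (ℕP.m⊔n≤o⇒m≤o M N n≥)) (δ≤y n (ℕP.m⊔n≤o⇒n≤o M N n≥))

  Pos-* : ∀ {x y} → Pos x → Pos y → Pos (x *ℝ y)
  Pos-* {x} {y} 0<x 0<y = 0<⇒Pos (*ℝ-pos {x} {y} (Pos⇒0< 0<x) (Pos⇒0< 0<y))

  Pos-resp : ∀ {x y} → x ≈ y → Pos x → Pos y
  Pos-resp {x} {y} (≈-intro x≃y) (mkPos {ε} 0<ε {M} ε≤x) =
    let N , xy = x≃y (ε * ½) (*-pos 0<ε 0<½)
    in mkPos (*-pos 0<ε 0<½) {M ℕ.⊔ N} λ n n≥ →
         ≤-by (+-mono-≤ (ε≤x n (ℕP.m⊔n≤o⇒m≤o M N n≥))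
                        (≤-trans (p≤∣p∣ (seq x n - seq y n)) (xy n (ℕP.m⊔n≤o⇒n≤o M N n≥))))
           (solve 3 (λ x y e → y :- e :* con ½ := x :+ e :* con ½ :- (e :+ (x :- y))) refl (seq x n) (seq y n) ε)

  ¬Pos-0 : ∀ {x} → x ≈ 0ℝ → ¬ Pos x
  ¬Pos-0 x≈0 0<x = absurd (Pos-resp x≈0 0<x)
    where
    absurd : ¬ Pos 0ℝ
    absurd (mkPos 0<ε {N} ε≤0) = <-irrefl refl (<-≤-trans 0<ε (ε≤0 N ℕP.≤-refl))

  -- One rational comparison suffices once the sequence moves by at most ε/2 from there on: the
  -- other half of the margin survives.
  Pos-at : ∀ {x ε N} → 0ℚ < ε → ε ≤ seq x N →
    (∀ m n → N ℕ.≤ m → N ℕ.≤ n → ∣ seq x m - seq x n ∣ ≤ ε * ½) → Pos x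
  Pos-at {x} {ε} {N} 0<ε ε≤xN close = mkPos (*-pos 0<ε 0<½) {N} λ n n≥ →
    ≤-by (+-mono-≤ ε≤xN (≤-trans (p≤∣p∣ (seq x N - seq x n)) (close N n ℕP.≤-refl n≥)))
      (solve 3 (λ x y e → y :- e :* con ½ := x :+ e :* con ½ :- (e :+ (x :- y))) refl (seq x N) (seq x n) ε)

  -- One of the summands must supply half of the margin ε. Which one is decided by a rational
  -- comparison at an index beyond which neither sequence moves by more than ε/4.
  Pos-split : ∀ {x y} → Pos (x +ℝ y) → Pos x ⊎ Pos y
  Pos-split {x} {y} (mkPos {ε} 0<ε {K} ε≤) = go (cauchy x (h * ½) (*-pos 0<h 0<½)) (cauchy y (h * ½) (*-pos 0<h 0<½))
    where
    h = ε * ½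
    0<h = *-pos 0<ε 0<½
    go : (∃[ M ] ∀ m n → M ℕ.≤ m → M ℕ.≤ n → ∣ seq x m - seq x n ∣ ≤ h * ½) →
         (∃[ N ] ∀ m n → N ℕ.≤ m → N ℕ.≤ n → ∣ seq y m - seq y n ∣ ≤ h * ½) → Pos x ⊎ Pos y
    go (M , xM) (N , yN) with h ≤? seq x (K ℕ.⊔ (M ℕ.⊔ N))
    ... | yes h≤x = inj₁ (Pos-at 0<h h≤x λ m n m≥ n≥ → xM m n (M≤ m≥) (M≤ n≥))
      where
      M≤ : ∀ {n} → K ℕ.⊔ (M ℕ.⊔ N) ℕ.≤ n → M ℕ.≤ n
      M≤ n≥ = ℕP.m⊔n≤o⇒m≤o M N (ℕP.m⊔n≤o⇒n≤o K (M ℕ.⊔ N) n≥)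
    ... | no h≰x = inj₂ (Pos-at 0<h h≤y λ m n m≥ n≥ → yN m n (N≤ m≥) (N≤ n≥))
      where
      T = K ℕ.⊔ (M ℕ.⊔ N)
      N≤ : ∀ {n} → T ℕ.≤ n → N ℕ.≤ n
      N≤ n≥ = ℕP.m⊔n≤o⇒n≤o M N (ℕP.m⊔n≤o⇒n≤o K (M ℕ.⊔ N) n≥)
      h≤y : h ≤ seq y T
      h≤y = ≤-by (+-mono-≤ (ε≤ T (ℕP.m≤m⊔n K (M ℕ.⊔ N))) (<⇒≤ (≰⇒> h≰x)))
        (solve 3 (λ x y e → y :- e :* con ½ := x :+ y :+ e :* con ½ :- (e :+ x)) refl (seq x T) (seq y T) ε)

  -- For rational ε > 0, `Pos-split` applied to ε = (ε - x) + x rules out the second summand, so x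
  -- is eventually at most ε; likewise for -x. This is what admits arguments by contradiction on
  -- signs.
  ≈0-stable : ∀ {x} → ¬ Pos x → ¬ Pos (-ℝ x) → x ≈ 0ℝ
  ≈0-stable {x} ¬0<x ¬0<-x = ≈-intro λ ε 0<ε → go ε (below x ¬0<x 0<ε) (below (-ℝ x) ¬0<-x 0<ε)
    where
    below : ∀ x → ¬ Pos x → ∀ {ε} → 0ℚ < ε → ∃[ N ] ∀ n → N ℕ.≤ n → seq x n ≤ ε
    below x ¬0<x {ε} 0<ε = near (Pos-split (Pos-pointwise
      (λ n → solve 2 (λ x e → e := e :- x :+ x) refl (seq x n) ε) (Pos-fromℚ 0<ε)))
      where
      near : Pos (fromℚ ε -ℝ x) ⊎ Pos x → ∃[ N ] ∀ n → N ℕ.≤ n → seq x n ≤ ε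
      near (inj₂ 0<x) = contradiction 0<x ¬0<x
      near (inj₁ (mkPos 0<δ {N} δ≤)) = N , λ n n≥ → ≤-by (≤-trans (<⇒≤ 0<δ) (δ≤ n n≥))
        (solve 2 (λ x e → e :- x := e :- x :- con 0ℚ) refl (seq x n) ε)
    go : ∀ ε → (∃[ M ] ∀ n → M ℕ.≤ n → seq x n ≤ ε) → (∃[ N ] ∀ n → N ℕ.≤ n → - seq x n ≤ ε) →
         ∃[ N ] ∀ n → N ℕ.≤ n → ∣ seq x n - 0ℚ ∣ ≤ ε
    go ε (M , xM) (N , xN) = M ℕ.⊔ N , λ n n≥ → subst (_≤ ε) (cong ∣_∣ (sym (+-identityʳ (seq x n))))
      (∣∣≤-intro (xM n (ℕP.m⊔n≤o⇒m≤o M N n≥)) (xN n (ℕP.m⊔n≤o⇒n≤o M N n≥)))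

  -- Either sign of x would give the product a sign.
  *-cancel-0 : ∀ {x y} → Pos y → x *ℝ y ≈ 0ℝ → x ≈ 0ℝ
  *-cancel-0 {x} {y} 0<y xy≈0 = ≈0-stable
    (λ 0<x → ¬Pos-0 xy≈0 (Pos-* {x} {y} 0<x 0<y))
    (λ 0<-x → ¬Pos-0
      (≈-by (fromℚ (- 1ℚ) · xy≈0) λ n → solve 2 (λ x y →
        (:- x) :* y :- con 0ℚ := con (- 1ℚ) :* (x :* y :- con 0ℚ)) refl (seq x n) (seq y n))
      (Pos-* { -ℝ x} {y} 0<-x 0<y))

  recip-inverse : ∀ x 0<x → x *ℝ recip x 0<x ≈ 1ℝ
  recip-inverse x (ε , 0<ε , K , ε≤x) = ≈-intro λ δ 0<δ → K , λ n n≥ →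
    let 0<m = <-≤-trans 0<ε (p≤p⊔q ε (seq x n))
        m≡x = p≤q⇒p⊔q≡q (subst (_≤ seq x n) (+-identityˡ ε) (ε≤x n n≥))
        eq : seq x n * invPos (ε ⊔ seq x n) 0<m ≡ 1ℚ
        eq = trans (cong (_* invPos (ε ⊔ seq x n) 0<m) (sym m≡x)) (invPos-inverse (ε ⊔ seq x n) 0<m)
    in subst (_≤ δ) (cong ∣_∣ (sym (cong (_- 1ℚ) eq))) (<⇒≤ 0<δ)

  -- Sine and cosine

  -- Both sequences eventually lie within b + d of 0, where all partial sums share one Lipschitz
  -- constant, a bound for the exponential sums.
  powerSeries-cong : ∀ s s≤1 {x y} → x ≈ y → powerSeries s s≤1 x ≈ powerSeries s s≤1 y
  powerSeries-cong s s≤1 {x} {y} (≈-intro x≃y) = go (eventuallyBounded x) (eventuallyBounded y)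
    where
    go : (∃[ b ] 0ℚ < b × (∃[ N ] ∀ n → N ℕ.≤ n → ∣ seq x n ∣ ≤ b)) →
         (∃[ b ] 0ℚ < b × (∃[ N ] ∀ n → N ℕ.≤ n → ∣ seq y n ∣ ≤ b)) →
         powerSeries s s≤1 x ≈ powerSeries s s≤1 y
    go (b , 0<b , M , x≤b) (d , 0<d , N , y≤d) = ≈-intro λ ε 0<ε →
      let K , xy = x≃y (ε * invPos bound 0<bound) (*-pos 0<ε (invPos-pos bound 0<bound))
      -- The index must be a successor: `partialSum-lipschitz` speaks of partial sums of length n +
      -- 1.
      in suc (M ℕ.⊔ (N ℕ.⊔ K)) , λ where
        (suc n) (ℕ.s≤s n≥) →
          let M≤n  = ℕP.m≤n⇒m≤1+n (ℕP.m⊔n≤o⇒m≤o M (N ℕ.⊔ K) n≥)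
              NK≤n = ℕP.m⊔n≤o⇒n≤o M (N ℕ.⊔ K) n≥
              N≤n  = ℕP.m≤n⇒m≤1+n (ℕP.m⊔n≤o⇒m≤o N K NK≤n)
              K≤n  = ℕP.m≤n⇒m≤1+n (ℕP.m⊔n≤o⇒n≤o N K NK≤n)
          in ≤-trans
               (partialSum-lipschitz s s≤1 {seq x (suc n)} {seq y (suc n)} {b + d}
                 (≤-trans (x≤b (suc n) M≤n) (p≤p+nonNeg b (<⇒≤ 0<d)))
                 (≤-trans (y≤d (suc n) N≤n) (subst (d ≤_) (+-comm d b) (p≤p+nonNeg d (<⇒≤ 0<b)))) n)
               (subst (∣ seq x (suc n) - seq y (suc n) ∣ * expSum (b + d) n ≤_) (scale-cancel ε bound 0<bound)
                 (*-mono (<⇒≤ (*-pos 0<ε (invPos-pos bound 0<bound))) (expSum-nonNeg n) (xy (suc n) K≤n) (expSum≤bound n)))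
      where
      0≤b+d : 0ℚ ≤ b + d
      0≤b+d = +-mono-≤ (<⇒≤ 0<b) (<⇒≤ 0<d)
      open Tail 0≤b+d
      expSum-nonNeg : ∀ n → 0ℚ ≤ expSum (b + d) n
      expSum-nonNeg n = subst (0ℚ ≤_) (sym (expSum-Σ< (b + d) n)) (Σ<-nonNeg (powOverFact-nonNeg 0≤b+d) n)

  sin-cong : ∀ {x y} → x ≈ y → sin x ≈ sin y
  sin-cong = powerSeries-cong sinSign ∣sinSign∣≤1

  cos-cong : ∀ {x y} → x ≈ y → cos x ≈ cos y
  cos-cong = powerSeries-cong cosSign ∣cosSign∣≤1

  -- The signs s and t are quantified after N, so that one index serves both products of an addition
  -- formula.
  product-close : ∀ x y ε → 0ℚ < ε → ∃[ N ] ∀ n → N ℕ.≤ n →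
    ∀ {s t} → (∀ j → ∣ s j ∣ ≤ 1ℚ) → (∀ j → ∣ t j ∣ ≤ 1ℚ) →
    ∣ partialSum s (seq x n) n * partialSum t (seq y n) n
      - triangle (s ⊙ powOverFact (seq x n)) (t ⊙ powOverFact (seq y n)) n ∣ ≤ ε
  product-close x y ε 0<ε = go (eventuallyBounded x) (eventuallyBounded y)
    where
    go : (∃[ b ] 0ℚ < b × (∃[ N ] ∀ n → N ℕ.≤ n → ∣ seq x n ∣ ≤ b)) →
         (∃[ b ] 0ℚ < b × (∃[ N ] ∀ n → N ℕ.≤ n → ∣ seq y n ∣ ≤ b)) →
         ∃[ N ] ∀ n → N ℕ.≤ n →
         ∀ {s t} → (∀ j → ∣ s j ∣ ≤ 1ℚ) → (∀ j → ∣ t j ∣ ≤ 1ℚ) →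
         ∣ partialSum s (seq x n) n * partialSum t (seq y n) n
           - triangle (s ⊙ powOverFact (seq x n)) (t ⊙ powOverFact (seq y n)) n ∣ ≤ ε
    go (b , 0<b , M , x≤b) (d , 0<d , N , y≤d) =
      let K , small = Tail.tail-small (+-mono-≤ (<⇒≤ 0<b) (<⇒≤ 0<d)) ε 0<ε
      in M ℕ.⊔ (N ℕ.⊔ K) , λ n n≥ s≤1 t≤1 →
        let M≤n  = ℕP.m⊔n≤o⇒m≤o M (N ℕ.⊔ K) n≥
            NK≤n = ℕP.m⊔n≤o⇒n≤o M (N ℕ.⊔ K) n≥
        in ≤-trans (partialSum-product s≤1 t≤1 (x≤b n M≤n) (y≤d n (ℕP.m⊔n≤o⇒m≤o N K NK≤n)) n)
             (small n n (ℕP.m⊔n≤o⇒n≤o N K NK≤n))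

  sin-+ : ∀ x y → sin (x +ℝ y) ≈ sin x *ℝ cos y +ℝ cos x *ℝ sin y
  sin-+ x y = ≈-intro λ ε 0<ε →
    let N , close = product-close x y (ε * ½) (*-pos 0<ε 0<½)
    in N , λ n n≥ →
      let p = seq x n
          q = seq y n
          S = partialSum sinSign
          C = partialSum cosSign
          T = triangle (sinSign ⊙ powOverFact p) (cosSign ⊙ powOverFact q) n
          U = triangle (cosSign ⊙ powOverFact p) (sinSign ⊙ powOverFact q) n
      in subst₂ _≤_
           (trans (∣p-q∣≡∣q-p∣ (S p n * C q n + C p n * S q n) (T + U))
             (cong (λ z → ∣ z - (S p n * C q n + C p n * S q n) ∣) (sym (sinSum-+ p q n))))
           (half+half ε)
           (subst (λ z → ∣ z ∣ ≤ ε * ½ + ε * ½)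
             (solve 4 (λ a b t u → (a :- t) :+ (b :- u) := a :+ b :- (t :+ u)) refl (S p n * C q n) (C p n * S q n) T U)
             (∣+∣-mono {S p n * C q n - T} (close n n≥ ∣sinSign∣≤1 ∣cosSign∣≤1) (close n n≥ ∣cosSign∣≤1 ∣sinSign∣≤1)))

  cos-+ : ∀ x y → cos (x +ℝ y) ≈ cos x *ℝ cos y -ℝ sin x *ℝ sin y
  cos-+ x y = ≈-intro λ ε 0<ε →
    let N , close = product-close x y (ε * ½) (*-pos 0<ε 0<½)
    in N , λ n n≥ →
      let p = seq x n
          q = seq y n
          S = partialSum sinSign
          C = partialSum cosSign
          T = triangle (cosSign ⊙ powOverFact p) (cosSign ⊙ powOverFact q) n
          U = triangle (sinSign ⊙ powOverFact p) (sinSign ⊙ powOverFact q) n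
      in subst₂ _≤_
           (cong (λ z → ∣ z - (C p n * C q n - S p n * S q n) ∣) (sym (cosSum-+ p q n)))
           (half+half ε)
           (subst (λ z → ∣ z ∣ ≤ ε * ½ + ε * ½)
             (solve 4 (λ a b t u → (t :- a) :+ (b :- u) := t :- u :- (a :- b)) refl (C p n * C q n) (S p n * S q n) T U)
             (∣+∣-mono {T - C p n * C q n}
               (subst (_≤ ε * ½) (∣p-q∣≡∣q-p∣ (C p n * C q n) T) (close n n≥ ∣cosSign∣≤1 ∣cosSign∣≤1))
               (close n n≥ ∣sinSign∣≤1 ∣sinSign∣≤1)))

  -- Two steps multiply the term by -p²/((j + 1)(j + 2)), which is even in p; the induction
  -- therefore advances by two, as it does for the cosine.
  sinTerm-neg : ∀ p j → sinSign j * powOverFact (- p) j ≡ - (sinSign j * powOverFact p j)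
  sinTerm-neg p zero          = refl
  sinTerm-neg p (suc zero)    = solve 1 (λ p → con 1ℚ :* (con 1ℚ :* (:- p) :* con 1ℚ) := :- (con 1ℚ :* (con 1ℚ :* p :* con 1ℚ))) refl p
  sinTerm-neg p (suc (suc j)) = begin
    - s * (e′ * - p * i * - p * i′)   ≡⟨ solve 5 (λ s e p i i′ → (:- s) :* (e :* (:- p) :* i :* (:- p) :* i′) := (:- (p :* i :* p :* i′)) :* (s :* e)) refl s e′ p i i′ ⟩
    - (p * i * p * i′) * (s * e′)     ≡⟨ cong (- (p * i * p * i′) *_) (sinTerm-neg p j) ⟩
    - (p * i * p * i′) * - (s * e)    ≡⟨ solve 5 (λ s e p i i′ → (:- (p :* i :* p :* i′)) :* (:- (s :* e)) := :- ((:- s) :* (e :* p :* i :* p :* i′))) refl s e p i i′ ⟩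
    - (- s * (e * p * i * p * i′))    ∎
    where
    open ≡-Reasoning
    s = sinSign j
    e = powOverFact p j
    e′ = powOverFact (- p) j
    i = invSuc j
    i′ = invSuc (suc j)

  cosTerm-neg : ∀ p j → cosSign j * powOverFact (- p) j ≡ cosSign j * powOverFact p j
  cosTerm-neg p zero          = refl
  cosTerm-neg p (suc zero)    = trans (*-zeroˡ (powOverFact (- p) 1)) (sym (*-zeroˡ (powOverFact p 1)))
  cosTerm-neg p (suc (suc j)) = begin
    - s * (e′ * - p * i * - p * i′)   ≡⟨ solve 5 (λ s e p i i′ → (:- s) :* (e :* (:- p) :* i :* (:- p) :* i′) := (:- (p :* i :* p :* i′)) :* (s :* e)) refl s e′ p i i′ ⟩
    - (p * i * p * i′) * (s * e′)     ≡⟨ cong (- (p * i * p * i′) *_) (cosTerm-neg p j) ⟩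
    - (p * i * p * i′) * (s * e)      ≡⟨ solve 5 (λ s e p i i′ → (:- (p :* i :* p :* i′)) :* (s :* e) := (:- s) :* (e :* p :* i :* p :* i′)) refl s e p i i′ ⟩
    - s * (e * p * i * p * i′)        ∎
    where
    open ≡-Reasoning
    s = cosSign j
    e = powOverFact p j
    e′ = powOverFact (- p) j
    i = invSuc j
    i′ = invSuc (suc j)

  sinSum-neg : ∀ p n → partialSum sinSign (- p) n ≡ - partialSum sinSign p n
  sinSum-neg p zero    = refl
  sinSum-neg p (suc n) = trans (cong₂ _+_ (sinSum-neg p n) (sinTerm-neg p n))
    (sym (neg-distrib-+ (partialSum sinSign p n) _))

  cosSum-neg : ∀ p n → partialSum cosSign (- p) n ≡ partialSum cosSign p n
  cosSum-neg p zero    = refl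
  cosSum-neg p (suc n) = cong₂ _+_ (cosSum-neg p n) (cosTerm-neg p n)

  sin-neg : ∀ x → sin (-ℝ x) ≈ -ℝ sin x
  sin-neg x = ≈-pointwise λ n → sinSum-neg (seq x n) n

  cos-neg : ∀ x → cos (-ℝ x) ≈ cos x
  cos-neg x = ≈-pointwise λ n → cosSum-neg (seq x n) n

  sin-- : ∀ x y → sin (x -ℝ y) ≈ sin x *ℝ cos y -ℝ cos x *ℝ sin y
  sin-- x y = ≈-by (1ℝ · sin-+ x (-ℝ y) ⊕ sin x · cos-neg y ⊕ cos x · sin-neg y) λ n →
    solve 7 (λ A s c C S C′ S′ → A :- (s :* C :- c :* S) :=
        con 1ℚ :* (A :- (s :* C′ :+ c :* S′)) :+ s :* (C′ :- C) :+ c :* (S′ :- (:- S))) refl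
      (seq (sin (x -ℝ y)) n) (seq (sin x) n) (seq (cos x) n) (seq (cos y) n) (seq (sin y) n)
      (seq (cos (-ℝ y)) n) (seq (sin (-ℝ y)) n)

  -- For 0 ≤ p ≤ 1 every term from p²/2 on is at most half of the previous one,
  -- which keeps p² above the distance to p plus twice the next term.
  sinSum-close : ∀ {p} → 0ℚ ≤ p → p ≤ 1ℚ → ∀ n →
    ∣ partialSum sinSign p (2 ℕ.+ n) - p ∣ + 2ℚ * powOverFact p (2 ℕ.+ n) ≤ p * p
  sinSum-close {p} 0≤p p≤1 zero = ≤-reflexive (trans
    (cong (λ z → ∣ z ∣ + 2ℚ * (1ℚ * p * 1ℚ * p * ½))
      (solve 1 (λ p → con 0ℚ :+ con 0ℚ :* con 1ℚ :+ con 1ℚ :* (con 1ℚ :* p :* con 1ℚ) :- p := con 0ℚ) refl p))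
    (solve 1 (λ p → con 0ℚ :+ con 2ℚ :* (con 1ℚ :* p :* con 1ℚ :* p :* con ½) := p :* p) refl p))
  sinSum-close {p} 0≤p p≤1 (suc n) = begin
    ∣ S + s * e - p ∣ + 2ℚ * (e * p * i)   ≤⟨ +-mono-≤ triangle-≤ (*-monoˡ-≤-nonNeg 2ℚ halves) ⟩
    ∣ S - p ∣ + e + 2ℚ * (e * ½)           ≡⟨ solve 2 (λ d e → d :+ e :+ con 2ℚ :* (e :* con ½) := d :+ con 2ℚ :* e) refl (∣ S - p ∣) e ⟩
    ∣ S - p ∣ + 2ℚ * e                     ≤⟨ sinSum-close 0≤p p≤1 n ⟩
    p * p                                  ∎
    where
    open ≤-Reasoning
    S = partialSum sinSign p (2 ℕ.+ n)
    s = sinSign (2 ℕ.+ n)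
    e = powOverFact p (2 ℕ.+ n)
    i = invSuc (2 ℕ.+ n)
    0≤e : 0ℚ ≤ e
    0≤e = powOverFact-nonNeg 0≤p (2 ℕ.+ n)
    triangle-≤ : ∣ S + s * e - p ∣ ≤ ∣ S - p ∣ + e
    triangle-≤ = subst₂ _≤_
      (cong ∣_∣ (solve 3 (λ S t p → S :- p :+ t := S :+ t :- p) refl S (s * e) p))
      (cong (λ z → ∣ S - p ∣ + z) (*-identityˡ e))
      (∣+∣-mono {S - p} ≤-refl (∣*∣-mono {s} (∣sinSign∣≤1 (2 ℕ.+ n)) (≤-reflexive (0≤p⇒∣p∣≡p 0≤e))))
    i≤½ : i ≤ ½
    i≤½ = subst₂ _≤_ (*-identityˡ i) (*-identityˡ ½)
      (fraction-≤ {1} {1} {2 ℕ.+ n} {1} (ℕ.s≤s (ℕ.s≤s ℕ.z≤n)))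
    halves : e * p * i ≤ e * ½
    halves = subst (e * p * i ≤_) (cong (_* ½) (*-identityʳ e))
      (*-mono (*-nonNeg 0≤e (<⇒≤ 0<1)) (<⇒≤ (0<invSuc (2 ℕ.+ n))) (*-monoˡ-≤-nonNeg e {{nonNegative 0≤e}} p≤1) i≤½)

  -- `sinSum-close` gives at least p - p², and p² ≤ p/2 on this range.
  sinSum-≥ : ∀ {p} → 0ℚ ≤ p → p ≤ ½ → ∀ n → p * ½ ≤ partialSum sinSign p (2 ℕ.+ n)
  sinSum-≥ {p} 0≤p p≤½ n = ≤-by
    (+-mono-≤
      (≤-trans (∣∣≤⇒-≤ {S - p} ≤-refl)
        (≤-trans (p≤p+nonNeg ∣ S - p ∣ (*-nonNeg (<⇒≤ (positive⁻¹ 2ℚ)) (powOverFact-nonNeg 0≤p (2 ℕ.+ n))))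
          (sinSum-close 0≤p (≤-trans p≤½ (p≤p+nonNeg ½ (<⇒≤ 0<½))) n)))
      (*-monoˡ-≤-nonNeg p {{nonNegative 0≤p}} p≤½))
    (solve 2 (λ S p → S :- p :* con ½ := p :* p :+ p :* con ½ :- ((:- (S :- p)) :+ p :* p)) refl S p)
    where S = partialSum sinSign p (2 ℕ.+ n)

  sin-pos-small : ∀ t → Pos t → Pos (fromℚ ½ -ℝ t) → Pos (sin t)
  sin-pos-small t (mkPos {ε} 0<ε {M} ε≤t) (mkPos 0<δ {N} δ≤) = mkPos (*-pos 0<ε 0<½) {2 ℕ.+ (M ℕ.⊔ N)} λ where
    (suc (suc n)) (ℕ.s≤s (ℕ.s≤s n≥)) →
      let m = suc (suc n)
          ε≤p = ε≤t m (ℕP.m≤n⇒m≤1+n (ℕP.m≤n⇒m≤1+n (ℕP.m⊔n≤o⇒m≤o M N n≥)))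
          p≤½ : seq t m ≤ ½
          p≤½ = ≤-by (≤-trans (<⇒≤ 0<δ) (δ≤ m (ℕP.m≤n⇒m≤1+n (ℕP.m≤n⇒m≤1+n (ℕP.m⊔n≤o⇒n≤o M N n≥)))))
            (solve 1 (λ p → con ½ :- p := con ½ :- p :- con 0ℚ) refl (seq t m))
      in ≤-trans (*-monoʳ-≤-nonNeg ½ ε≤p) (sinSum-≥ (≤-trans (<⇒≤ 0<ε) ε≤p) p≤½ n)

  sin-double : ∀ t → sin t ≈ fromℚ 2ℚ *ℝ (sin (half t) *ℝ cos (half t))
  sin-double t = ≈-by (1ℝ · sin-cong halves ⊕ 1ℝ · sin-+ (half t) (half t)) λ n →
    solve 4 (λ A B s c → A :- con 2ℚ :* (s :* c) := con 1ℚ :* (A :- B) :+ con 1ℚ :* (B :- (s :* c :+ c :* s))) refl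
      (seq (sin t) n) (seq (sin (half t +ℝ half t)) n) (seq (sin (half t)) n) (seq (cos (half t)) n)
    where
    halves : t ≈ half t +ℝ half t
    halves = ≈-pointwise λ n → solve 1 (λ t → t := con ½ :* t :+ con ½ :* t) refl (seq t n)

  -- Zeros of the sine in (-π, π) and the angle π/4

  quarter : ℝ → ℝ
  quarter x = fromℚ (+ 1 / 4) *ℝ x

  module Trigonometry {π : ℝ} (isPi : IsPi π) where

    open IsPi isPi

    π-pos : Pos π
    π-pos = 0<⇒Pos positive-π

    half-π-pos : Pos (half π)
    half-π-pos = Pos-* {fromℚ ½} {π} (Pos-fromℚ 0<½) π-pos

    quarter-pos : Pos (quarter π)
    quarter-pos = Pos-* {fromℚ (+ 1 / 4)} {π} (Pos-fromℚ (positive⁻¹ (+ 1 / 4))) π-pos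

    -- Repeated halving reduces to small arguments; cos is positive at every
    -- half because it is below π/2.
    sin-pos-below : ∀ m t → Pos t → Pos (π -ℝ t) → Pos (fromℚ (fromℕ m * ½ + ½) -ℝ t) → Pos (sin t)
    sin-pos-below zero    t 0<t t<π t<b =
      sin-pos-small t 0<t (subst (λ b → Pos (fromℚ b -ℝ t)) {fromℕ 0 * ½ + ½} {½} refl t<b)
    sin-pos-below (suc m) t 0<t t<π t<b = Pos-resp (≈-sym (sin-double t))
      (Pos-* {fromℚ 2ℚ} {sin (half t) *ℝ cos (half t)} (Pos-fromℚ (positive⁻¹ 2ℚ)) (Pos-* {sin (half t)} {cos (half t)} 0<sin 0<cos))
      where
      0<half : Pos (half t)
      0<half = Pos-* {fromℚ ½} {t} (Pos-fromℚ 0<½) 0<t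
      half<π : Pos (π -ℝ half t)
      half<π = Pos-pointwise
        (λ n → solve 2 (λ π t → π :- t :+ con ½ :* t := π :- con ½ :* t) refl (seq π n) (seq t n))
        (Pos-+ {π -ℝ t} {half t} t<π 0<half)
      -- Half of the bound (m + 1)/2 + ½ is m/4 + ½, which does not exceed the bound m/2 + ½ for m.
      half<b : Pos (fromℚ (fromℕ m * ½ + ½) -ℝ half t)
      half<b = Pos-mono
        (λ n → ≤-by (*-nonNeg (0≤fromℕ m) (*-nonNeg (<⇒≤ 0<½) (<⇒≤ 0<½)))
          (trans (cong (λ z → fromℕ m * ½ + ½ - ½ * seq t n - ½ * (z * ½ + ½ - seq t n)) (fromℕ-suc m))
            (solve 2 (λ m t → m :* con ½ :+ con ½ :- con ½ :* t :- con ½ :* ((m :+ con 1ℚ) :* con ½ :+ con ½ :- t)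
                := m :* (con ½ :* con ½) :- con 0ℚ) refl (fromℕ m) (seq t n))))
        (Pos-* {fromℚ ½} {fromℚ (fromℕ (suc m) * ½ + ½) -ℝ t} (Pos-fromℚ 0<½) t<b)
      0<sin : Pos (sin (half t))
      0<sin = sin-pos-below m (half t) 0<half half<π half<b
      0<cos : Pos (cos (half t))
      0<cos = 0<⇒Pos (cos-first (half t) (Pos⇒0< 0<half) (Pos⇒< {half t} {half π} (Pos-pointwise
        (λ n → solve 2 (λ π t → con ½ :* (π :- t) := con ½ :* π :- con ½ :* t) refl (seq π n) (seq t n))
        (Pos-* {fromℚ ½} {π -ℝ t} (Pos-fromℚ 0<½) t<π))))

    sin-pos : ∀ t → Pos t → Pos (π -ℝ t) → Pos (sin t)
    sin-pos t 0<t t<π = go (eventuallyBounded t)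
      where
      go : (∃[ b ] 0ℚ < b × (∃[ N ] ∀ n → N ℕ.≤ n → ∣ seq t n ∣ ≤ b)) → Pos (sin t)
      go (b , 0<b , N , t≤b) = sin-pos-below m t 0<t t<π
        (mkPos 0<½ {N} λ n n≥ → ≤-by
          (+-mono-≤ (≤-trans (p≤∣p∣ (seq t n)) (t≤b n n≥)) (*-monoʳ-≤-nonNeg ½ (proj₂ (archimedean (2ℚ * b)))))
          (solve 3 (λ m t b → m :* con ½ :+ con ½ :- t :- con ½ := b :+ m :* con ½ :- (t :+ con 2ℚ :* b :* con ½)) refl
            (fromℕ m) (seq t n) b))
        -- From m ≥ 2b it follows that m/2 + ½ exceeds t by at least the margin ½.
        where m = proj₁ (archimedean (2ℚ * b))

    sin≈0⇒≈0 : ∀ t → Pos (π -ℝ t) → Pos (π +ℝ t) → sin t ≈ 0ℝ → t ≈ 0ℝ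
    sin≈0⇒≈0 t t<π -π<t sin≈0 = ≈0-stable
      (λ 0<t → ¬Pos-0 sin≈0 (sin-pos t 0<t t<π))
      (λ 0<-t → ¬Pos-0
        (≈-by (1ℝ · sin-neg t ⊕ fromℚ (- 1ℚ) · sin≈0) λ n →
          solve 2 (λ S s → S :- con 0ℚ := con 1ℚ :* (S :- (:- s)) :+ con (- 1ℚ) :* (s :- con 0ℚ)) refl
            (seq (sin (-ℝ t)) n) (seq (sin t) n))
        (sin-pos (-ℝ t) 0<-t (Pos-pointwise
          (λ n → solve 2 (λ π t → π :+ t := π :- (:- t)) refl (seq π n) (seq t n)) -π<t)))

    quarter<π : Pos (π -ℝ quarter π)
    quarter<π = Pos-pointwise
      (λ n → solve 1 (λ π → con ½ :* π :+ con (+ 1 / 4) :* π := π :- con (+ 1 / 4) :* π) refl (seq π n))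
      (Pos-+ {half π} {quarter π} half-π-pos quarter-pos)

    sin-quarter-pos : Pos (sin (quarter π))
    sin-quarter-pos = sin-pos (quarter π) quarter-pos quarter<π

    cos-quarter-pos : Pos (cos (quarter π))
    cos-quarter-pos = 0<⇒Pos (cos-first (quarter π) (Pos⇒0< quarter-pos) (Pos⇒< {quarter π} {half π} (Pos-pointwise
      (λ n → solve 1 (λ π → con (+ 1 / 4) :* π := con ½ :* π :- con (+ 1 / 4) :* π) refl (seq π n))
      quarter-pos)))

    -- With c and s the two sides, 0 = cos (π/2) = c² - s² = (c - s)(c + s), and c + s is positive.
    cos≈sin-quarter : cos (quarter π) ≈ sin (quarter π)
    cos≈sin-quarter = ≈-by (1ℝ · difference) λ n →
      solve 2 (λ c s → c :- s := con 1ℚ :* (c :- s :- con 0ℚ)) refl (seq (cos (quarter π)) n) (seq (sin (quarter π)) n)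
      where
      doubled : quarter π +ℝ quarter π ≈ half π
      doubled = ≈-pointwise λ n →
        solve 1 (λ π → con (+ 1 / 4) :* π :+ con (+ 1 / 4) :* π := con ½ :* π) refl (seq π n)
      difference : cos (quarter π) -ℝ sin (quarter π) ≈ 0ℝ
      difference = *-cancel-0 {cos (quarter π) -ℝ sin (quarter π)} {cos (quarter π) +ℝ sin (quarter π)}
        (Pos-+ {cos (quarter π)} {sin (quarter π)} cos-quarter-pos sin-quarter-pos)
        (≈-by (fromℚ (- 1ℚ) · cos-+ (quarter π) (quarter π) ⊕ 1ℝ · cos-cong doubled ⊕ 1ℝ · ≈-intro {cos (half π)} {0ℝ} cos-zero) λ n →
          solve 4 (λ c s C H → (c :- s) :* (c :+ s) :- con 0ℚ
              := con (- 1ℚ) :* (C :- (c :* c :- s :* s)) :+ con 1ℚ :* (C :- H) :+ con 1ℚ :* (H :- con 0ℚ)) refl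
            (seq (cos (quarter π)) n) (seq (sin (quarter π)) n) (seq (cos (quarter π +ℝ quarter π)) n) (seq (cos (half π)) n))

    -- Here X = 1/P, and P² = L P + 1 makes tan 2α = 2X / (1 - X²) equal to 2/L,
    -- so that tan (π/4 - 2α) = (L - 2) / (L + 2) = Y.
    module AngleSum
      {α β X P : ℝ} {L Y : ℚ}
      (-π/2<α : Pos (half π +ℝ α)) (α<π/2 : Pos (half π -ℝ α))
      (-π/2<β : Pos (half π +ℝ β)) (β<π/2 : Pos (half π -ℝ β))
      (0<cosα : Pos (cos α))
      (sinα≈ : sin α ≈ X *ℝ cos α) (sinβ≈ : sin β ≈ fromℚ Y *ℝ cos β)
      (0<P : Pos P) (PX≈1 : P *ℝ X ≈ 1ℝ)
      (0<L : 0ℚ < L) (P²≈ : P *ℝ P ≈ fromℚ L *ℝ P +ℝ 1ℝ)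
      (Y≡ : Y * (2ℚ + L) ≡ L - 2ℚ)
      where

      c s cα sα cβ sβ S₂ C₂ Sₛ Cₛ L∞ Y∞ : ℝ
      c   = cos (quarter π)
      s   = sin (quarter π)
      cα  = cos α
      sα  = sin α
      cβ  = cos β
      sβ  = sin β
      S₂  = sin (α +ℝ α)
      C₂  = cos (α +ℝ α)
      Sₛ  = sin (α +ℝ α +ℝ β)
      Cₛ  = cos (α +ℝ α +ℝ β)
      L∞  = fromℚ L
      Y∞  = fromℚ Y

      -- Since P sin α = cos α, the sum P sin (-α) + cos α vanishes; for negative α both of its
      -- terms would be positive.
      ¬α<0 : ¬ Pos (-ℝ α)
      ¬α<0 α<0 = ¬Pos-0 {sin (-ℝ α) *ℝ P +ℝ cα}
        (≈-by (P · sin-neg α ⊕ (-ℝ P) · sinα≈ ⊕ (-ℝ cα) · PX≈1) λ n →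
          solve 5 (λ A s k P X → A :* P :+ k :- con 0ℚ
              := P :* (A :- (:- s)) :+ (:- P) :* (s :- X :* k) :+ (:- k) :* (P :* X :- con 1ℚ)) refl
            (seq (sin (-ℝ α)) n) (seq sα n) (seq cα n) (seq P n) (seq X n))
        (Pos-+ {sin (-ℝ α) *ℝ P} {cα}
          (Pos-* {sin (-ℝ α)} {P} (sin-pos (-ℝ α) α<0 -α<π) 0<P) 0<cosα)
        where
        -α<π : Pos (π -ℝ (-ℝ α))
        -α<π = Pos-pointwise {half π +ℝ α +ℝ half π}
          (λ n → solve 2 (λ π a → con ½ :* π :+ a :+ con ½ :* π := π :- (:- a)) refl (seq π n) (seq α n))
          (Pos-+ {half π +ℝ α} {half π} -π/2<α half-π-pos)

      -- From c = s, `G` = c cos α (X - 1). Multiplied by P (P + 1), the factor X - 1 becomes 1 - P²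
      -- = -L P, so `G` P (P + 1) and c cos α L P add up to 0; beyond π/4 both would be positive.
      ¬π/4<α : ¬ Pos (α -ℝ quarter π)
      ¬π/4<α q<α = ¬Pos-0 {G *ℝ (P *ℝ (P +ℝ 1ℝ)) +ℝ (c *ℝ cα) *ℝ (L∞ *ℝ P)}
        (≈-by ((P *ℝ (P +ℝ 1ℝ)) · sin-- α (quarter π) ⊕ (P *ℝ (P +ℝ 1ℝ) *ℝ c) · sinα≈ ⊕ (P *ℝ (P +ℝ 1ℝ) *ℝ cα) · cos≈sin-quarter
            ⊕ (c *ℝ cα *ℝ (P +ℝ 1ℝ)) · PX≈1 ⊕ (-ℝ (c *ℝ cα)) · P²≈) λ n →
          solve 8 (λ G a k c s P X L → G :* (P :* (P :+ con 1ℚ)) :+ c :* k :* (L :* P) :- con 0ℚ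
              := P :* (P :+ con 1ℚ) :* (G :- (a :* c :- k :* s))
                 :+ P :* (P :+ con 1ℚ) :* c :* (a :- X :* k)
                 :+ P :* (P :+ con 1ℚ) :* k :* (c :- s)
                 :+ c :* k :* (P :+ con 1ℚ) :* (P :* X :- con 1ℚ)
                 :+ (:- (c :* k)) :* (P :* P :- (L :* P :+ con 1ℚ))) refl
            (seq G n) (seq sα n) (seq cα n) (seq c n) (seq s n) (seq P n) (seq X n) L)
        (Pos-+ {G *ℝ (P *ℝ (P +ℝ 1ℝ))} {(c *ℝ cα) *ℝ (L∞ *ℝ P)}
          (Pos-* {G} {P *ℝ (P +ℝ 1ℝ)} (sin-pos (α -ℝ quarter π) q<α α-q<π)
            (Pos-* {P} {P +ℝ 1ℝ} 0<P (Pos-+ {P} {1ℝ} 0<P (Pos-fromℚ {1ℚ} 0<1))))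
          (Pos-* {c *ℝ cα} {L∞ *ℝ P} (Pos-* {c} {cα} cos-quarter-pos 0<cosα)
            (Pos-* {L∞} {P} (Pos-fromℚ {L} 0<L) 0<P)))
        where
        G : ℝ
        G = sin (α -ℝ quarter π)
        α-q<π : Pos (π -ℝ (α -ℝ quarter π))
        α-q<π = Pos-pointwise {half π -ℝ α +ℝ (half π +ℝ quarter π)}
          (λ n → solve 3 (λ π a q → con ½ :* π :- a :+ (con ½ :* π :+ q) := π :- (a :- q)) refl (seq π n) (seq α n) (seq (quarter π) n))
          (Pos-+ {half π -ℝ α} {half π +ℝ quarter π} α<π/2 (Pos-+ {half π} {quarter π} half-π-pos quarter-pos))

      -- The positive quantity (π/2 - β) + π/4 is the sum of this one and 2 (α - π/4), and the
      -- latter cannot be positive. The lower bound below uses -2α in the same way.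
      difference<π : Pos (π -ℝ (α +ℝ α +ℝ β -ℝ quarter π))
      difference<π = go (Pos-split {π -ℝ (α +ℝ α +ℝ β -ℝ quarter π)} {fromℚ 2ℚ *ℝ (α -ℝ quarter π)} (Pos-pointwise {half π -ℝ β +ℝ quarter π}
        (λ n → solve 3 (λ π a b → con ½ :* π :- b :+ con (+ 1 / 4) :* π
            := π :- (a :+ a :+ b :- con (+ 1 / 4) :* π) :+ con 2ℚ :* (a :- con (+ 1 / 4) :* π)) refl
          (seq π n) (seq α n) (seq β n))
        (Pos-+ {half π -ℝ β} {quarter π} β<π/2 quarter-pos)))
        where
        go : Pos (π -ℝ (α +ℝ α +ℝ β -ℝ quarter π)) ⊎ Pos (fromℚ 2ℚ *ℝ (α -ℝ quarter π)) → Pos (π -ℝ (α +ℝ α +ℝ β -ℝ quarter π))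
        go (inj₁ below) = below
        go (inj₂ above) = contradiction
          (Pos-pointwise {half (fromℚ 2ℚ *ℝ (α -ℝ quarter π))} {α -ℝ quarter π}
            (λ n → solve 2 (λ a q → con ½ :* (con 2ℚ :* (a :- q)) := a :- q) refl (seq α n) (seq (quarter π) n))
            (Pos-* {fromℚ ½} {fromℚ 2ℚ *ℝ (α -ℝ quarter π)} (Pos-fromℚ 0<½) above))
          ¬π/4<α

      -π<difference : Pos (π +ℝ (α +ℝ α +ℝ β -ℝ quarter π))
      -π<difference = go (Pos-split {π +ℝ (α +ℝ α +ℝ β -ℝ quarter π)} {fromℚ 2ℚ *ℝ (-ℝ α)} (Pos-pointwise {half π +ℝ β +ℝ quarter π}
        (λ n → solve 3 (λ π a b → con ½ :* π :+ b :+ con (+ 1 / 4) :* π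
            := π :+ (a :+ a :+ b :- con (+ 1 / 4) :* π) :+ con 2ℚ :* (:- a)) refl
          (seq π n) (seq α n) (seq β n))
        (Pos-+ {half π +ℝ β} {quarter π} -π/2<β quarter-pos)))
        where
        go : Pos (π +ℝ (α +ℝ α +ℝ β -ℝ quarter π)) ⊎ Pos (fromℚ 2ℚ *ℝ (-ℝ α)) → Pos (π +ℝ (α +ℝ α +ℝ β -ℝ quarter π))
        go (inj₁ above) = above
        go (inj₂ below) = contradiction
          (Pos-pointwise {half (fromℚ 2ℚ *ℝ (-ℝ α))} { -ℝ α}
            (λ n → solve 1 (λ a → con ½ :* (con 2ℚ :* (:- a)) := :- a) refl (seq α n))
            (Pos-* {fromℚ ½} {fromℚ 2ℚ *ℝ (-ℝ α)} (Pos-fromℚ 0<½) below))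
          ¬α<0

      -- The factor left in sin (2α + β) - cos (2α + β) after taking out cos β cos² α.
      defect : ℝ
      defect = fromℚ 2ℚ *ℝ X *ℝ (1ℝ +ℝ Y∞) -ℝ (1ℝ -ℝ X *ℝ X) *ℝ (1ℝ -ℝ Y∞)

      -- As (2 + L)(1 + Y) = 2L and (2 + L)(1 - Y) = 4, multiplying by 2 + L gives 4 (X² + L X - 1),
      -- and X² + L X = 1 is P² = L P + 1 multiplied by X².
      defect≈0 : defect ≈ 0ℝ
      defect≈0 = *-cancel-0 {defect} {fromℚ 2ℚ +ℝ L∞}
        (Pos-+ {fromℚ 2ℚ} {L∞} (Pos-fromℚ {2ℚ} (positive⁻¹ 2ℚ)) (Pos-fromℚ {L} 0<L))
        (≈-by ((fromℚ (- (+ 4 / 1)) *ℝ (X *ℝ X)) · P²≈ ⊕ (fromℚ (+ 4 / 1) *ℝ (P *ℝ X +ℝ 1ℝ -ℝ L∞ *ℝ X)) · PX≈1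
            ⊕ (fromℚ 2ℚ *ℝ X +ℝ 1ℝ -ℝ X *ℝ X) · Y∞≈) λ n →
          solve 4 (λ P X L Y →
              (con 2ℚ :* X :* (con 1ℚ :+ Y) :- (con 1ℚ :- X :* X) :* (con 1ℚ :- Y)) :* (con 2ℚ :+ L) :- con 0ℚ
              := con (- (+ 4 / 1)) :* (X :* X) :* (P :* P :- (L :* P :+ con 1ℚ))
                 :+ con (+ 4 / 1) :* (P :* X :+ con 1ℚ :- L :* X) :* (P :* X :- con 1ℚ)
                 :+ (con 2ℚ :* X :+ con 1ℚ :- X :* X) :* (Y :* (con 2ℚ :+ L) :- (L :- con 2ℚ))) refl
            (seq P n) (seq X n) L Y)
        where
        Y∞≈ : Y∞ *ℝ (fromℚ 2ℚ +ℝ L∞) ≈ L∞ -ℝ fromℚ 2ℚ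
        Y∞≈ = ≈-pointwise λ _ → Y≡

      sin-twice : S₂ ≈ fromℚ 2ℚ *ℝ X *ℝ (cα *ℝ cα)
      sin-twice = ≈-by (1ℝ · sin-+ α α ⊕ (fromℚ 2ℚ *ℝ cα) · sinα≈) λ n →
        solve 4 (λ S s k X → S :- con 2ℚ :* X :* (k :* k)
            := con 1ℚ :* (S :- (s :* k :+ k :* s)) :+ con 2ℚ :* k :* (s :- X :* k)) refl
          (seq S₂ n) (seq sα n) (seq cα n) (seq X n)

      cos-twice : C₂ ≈ (1ℝ -ℝ X *ℝ X) *ℝ (cα *ℝ cα)
      cos-twice = ≈-by (1ℝ · cos-+ α α ⊕ (-ℝ (sα +ℝ X *ℝ cα)) · sinα≈) λ n →
        solve 4 (λ C s k X → C :- (con 1ℚ :- X :* X) :* (k :* k)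
            := con 1ℚ :* (C :- (k :* k :- s :* s)) :+ (:- (s :+ X :* k)) :* (s :- X :* k)) refl
          (seq C₂ n) (seq sα n) (seq cα n) (seq X n)

      -- Stands in for tan (2α + β) = 1 without dividing by cos (2α + β).
      sin≈cos-sum : Sₛ ≈ Cₛ
      sin≈cos-sum = ≈-by
        (1ℝ · sin-+ (α +ℝ α) β ⊕ (-ℝ 1ℝ) · cos-+ (α +ℝ α) β ⊕ (C₂ +ℝ S₂) · sinβ≈
          ⊕ (cβ *ℝ (1ℝ +ℝ Y∞)) · sin-twice ⊕ (-ℝ (cβ *ℝ (1ℝ -ℝ Y∞))) · cos-twice
          ⊕ (cβ *ℝ (cα *ℝ cα)) · defect≈0) λ n →
        solve 9 (λ S C S₂ C₂ s c k X Y → S :- C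
            := con 1ℚ :* (S :- (S₂ :* c :+ C₂ :* s)) :+ (:- con 1ℚ) :* (C :- (C₂ :* c :- S₂ :* s))
               :+ (C₂ :+ S₂) :* (s :- Y :* c)
               :+ c :* (con 1ℚ :+ Y) :* (S₂ :- con 2ℚ :* X :* (k :* k))
               :+ (:- (c :* (con 1ℚ :- Y))) :* (C₂ :- (con 1ℚ :- X :* X) :* (k :* k))
               :+ c :* (k :* k) :* (con 2ℚ :* X :* (con 1ℚ :+ Y) :- (con 1ℚ :- X :* X) :* (con 1ℚ :- Y) :- con 0ℚ)) refl
          (seq Sₛ n) (seq Cₛ n) (seq S₂ n) (seq C₂ n) (seq sβ n) (seq cβ n) (seq cα n) (seq X n) Y

      sin-difference : sin (α +ℝ α +ℝ β -ℝ quarter π) ≈ 0ℝ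
      sin-difference = ≈-by (1ℝ · sin-- (α +ℝ α +ℝ β) (quarter π) ⊕ Cₛ · cos≈sin-quarter ⊕ c · sin≈cos-sum) λ n →
        solve 5 (λ D S C c s → D :- con 0ℚ
            := con 1ℚ :* (D :- (S :* c :- C :* s)) :+ C :* (c :- s) :+ c :* (S :- C)) refl
          (seq (sin (α +ℝ α +ℝ β -ℝ quarter π)) n) (seq Sₛ n) (seq Cₛ n) (seq c n) (seq s n)

      angle-sum : fromℚ (+ 1 / 4) *ℝ π ≈ fromℚ (+ 2 / 1) *ℝ α +ℝ β
      angle-sum = ≈-by
        (fromℚ (- 1ℚ) · sin≈0⇒≈0 (α +ℝ α +ℝ β -ℝ quarter π) difference<π -π<difference sin-difference) λ n →
        solve 3 (λ π a b → con (+ 1 / 4) :* π :- (con (+ 2 / 1) :* a :+ b)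
            := con (- 1ℚ) :* (a :+ a :+ b :- con (+ 1 / 4) :* π :- con 0ℚ)) refl
          (seq π n) (seq α n) (seq β n)

  tan-sin : ∀ θ 0<cos x → tan θ 0<cos ≈ x → sin θ ≈ x *ℝ cos θ
  tan-sin θ 0<cos x tan≈x = ≈-by
    ((-ℝ sin θ) · recip-inverse (cos θ) 0<cos ⊕ cos θ · tan≈x) λ n →
    solve 4 (λ s c r x → s :- x :* c := (:- s) :* (c :* r :- con 1ℚ) :+ c :* (s :* r :- x)) refl
      (seq (sin θ) n) (seq (cos θ) n) (seq (recip (cos θ) 0<cos) n) (seq x n)

  -- Powers of the golden mean and Lucas numbers

  -- For φ = (1 + r)/2 the difference φ² - φ - 1 equals (r² - 5)/4.
  φ-square : φ *ℝ φ ≈ φ +ℝ 1ℝ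
  φ-square = ≈-by (fromℚ (½ * ½) · ≈-intro {√ 5 *ℝ √ 5} {fromℚ (fromℕ 5)} (√-square 5)) λ n →
    solve 1 (λ r → con ½ :* (con 1ℚ :+ r) :* (con ½ :* (con 1ℚ :+ r)) :- (con ½ :* (con 1ℚ :+ r) :+ con 1ℚ)
      := con (½ * ½) :* (r :* r :- con (fromℕ 5))) refl (seq (√ 5) n)

  parity : ℕ → ℚ
  parity zero    = 1ℚ
  parity (suc n) = - parity n

  parity-odd : ∀ k → parity (2 ℕ.* k ℕ.+ 1) ≡ - 1ℚ
  parity-odd k = trans (cong parity (ℕP.+-comm (2 ℕ.* k) 1)) (cong -_ (even k))
    where
    even : ∀ k → parity (2 ℕ.* k) ≡ 1ℚ
    even zero    = refl
    even (suc k) = trans (cong parity (ℕP.*-distribˡ-+ 2 1 k)) (trans (solve 1 (λ s → :- (:- s) := s) refl (parity (2 ℕ.* k))) (even k))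

  fromℕ-+ : ∀ m n → fromℕ (m ℕ.+ n) ≡ fromℕ m + fromℕ n
  fromℕ-+ zero    n = sym (+-identityˡ (fromℕ n))
  fromℕ-+ (suc m) n = trans (fromℕ-suc (m ℕ.+ n)) (trans (cong (_+ 1ℚ) (fromℕ-+ m n))
    (trans (solve 2 (λ m n → m :+ n :+ con 1ℚ := m :+ con 1ℚ :+ n) refl (fromℕ m) (fromℕ n))
      (cong (_+ fromℕ n) (sym (fromℕ-suc m)))))

  ^ℝ-suc : ∀ x n → x ^ℝ suc n ≡ x *ℝ x ^ℝ n
  ^ℝ-suc x n = refl

  -- Variables tied by equations stand for the powers of φ, whose unfoldings
  -- are too large to be compared by conversion.
  lucas-φ-base : ∀ f {p p₁ a σ} → f *ℝ f ≈ f +ℝ 1ℝ → p ≡ 1ℝ → p₁ ≡ f *ℝ p → a ≡ 1ℚ → σ ≡ - 1ℚ →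
    fromℚ a *ℝ p₁ ≈ p₁ *ℝ p₁ +ℝ fromℚ σ
  lucas-φ-base f f² refl refl refl refl = ≈-by ((-ℝ 1ℝ) · f²) λ i →
    solve 1 (λ f → con 1ℚ :* (f :* con 1ℚ) :- (f :* con 1ℚ :* (f :* con 1ℚ) :+ con (- 1ℚ))
      := (:- con 1ℚ) :* (f :* f :- (f :+ con 1ℚ))) refl (seq f i)

  -- Adding f times the equation for n + 1 to f² times the one for n gives f² p² (f + 1) + σ (f² -
  -- f) on the right, and f² = f + 1 turns this into f⁴ p² + σ.
  lucas-φ-step : ∀ f p {p₁ p₂ a b c σ σ₁ σ₂} → f *ℝ f ≈ f +ℝ 1ℝ →
    p₁ ≡ f *ℝ p → p₂ ≡ f *ℝ p₁ → c ≡ a + b → σ₁ ≡ - σ → σ₂ ≡ - σ₁ →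
    fromℚ a *ℝ p₁ ≈ p₁ *ℝ p₁ +ℝ fromℚ σ₁ →
    fromℚ b *ℝ p ≈ p *ℝ p +ℝ fromℚ σ →
    fromℚ c *ℝ p₂ ≈ p₂ *ℝ p₂ +ℝ fromℚ σ₂
  lucas-φ-step f p {a = a} {b} {σ = σ} f² refl refl refl refl refl ap bp = ≈-by
    (f · ap ⊕ (f *ℝ f) · bp ⊕ (fromℚ σ -ℝ f *ℝ f *ℝ (p *ℝ p)) · f²) λ i →
    solve 5 (λ f p a b σ → (a :+ b) :* (f :* (f :* p)) :- (f :* (f :* p) :* (f :* (f :* p)) :+ (:- (:- σ)))
      := f :* (a :* (f :* p) :- (f :* p :* (f :* p) :+ (:- σ))) :+ f :* f :* (b :* p :- (p :* p :+ σ))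
         :+ (σ :- f :* f :* (p :* p)) :* (f :* f :- (f :+ con 1ℚ))) refl
      (seq f i) (seq p i) a b σ

  -- Binet's formula Lₙ = φⁿ + ψⁿ multiplied by φⁿ, where φψ = -1; in this form the conjugate ψ does
  -- not occur.
  LucasPower : ℕ → Set
  LucasPower n = fromℚ (fromℕ (lucas n)) *ℝ φ ^ℝ n ≈ φ ^ℝ n *ℝ φ ^ℝ n +ℝ fromℚ (parity n)

  lucas-φ-0 : LucasPower zero
  lucas-φ-0 = ≈-pointwise λ _ → refl

  lucas-φ-1 : LucasPower (suc zero)
  lucas-φ-1 = lucas-φ-base φ {φ ^ℝ zero} {φ ^ℝ suc zero} {fromℕ (lucas (suc zero))} {parity (suc zero)} φ-square refl (^ℝ-suc φ zero) refl refl

  lucas-φ-2+ : ∀ n → LucasPower (suc n) → LucasPower n → LucasPower (suc (suc n))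
  lucas-φ-2+ n = lucas-φ-step φ (φ ^ℝ n)
    {φ ^ℝ suc n} {φ ^ℝ suc (suc n)} {fromℕ (lucas (suc n))} {fromℕ (lucas n)} {fromℕ (lucas (suc (suc n)))}
    {parity n} {parity (suc n)} {parity (suc (suc n))}
    φ-square (^ℝ-suc φ n) (^ℝ-suc φ (suc n)) (fromℕ-+ (lucas (suc n)) (lucas n)) refl refl

  lucas-φ : ∀ n → LucasPower n
  lucas-φ zero          = lucas-φ-0
  lucas-φ (suc zero)    = lucas-φ-1
  lucas-φ (suc (suc n)) = lucas-φ-2+ n (lucas-φ (suc n)) (lucas-φ n)

  lucas-φ-odd : ∀ {n} → parity n ≡ - 1ℚ → φ ^ℝ n *ℝ φ ^ℝ n ≈ fromℚ (fromℕ (lucas n)) *ℝ φ ^ℝ n +ℝ 1ℝ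
  lucas-φ-odd {n} odd = rearrange (φ ^ℝ n) (fromℕ (lucas n)) (parity n) odd (lucas-φ n)
    where
    rearrange : ∀ p l σ → σ ≡ - 1ℚ → fromℚ l *ℝ p ≈ p *ℝ p +ℝ fromℚ σ → p *ℝ p ≈ fromℚ l *ℝ p +ℝ 1ℝ
    rearrange p l _ refl lp = ≈-by ((-ℝ 1ℝ) · lp) λ i →
      solve 2 (λ p l → p :* p :- (l :* p :+ con 1ℚ) := (:- con 1ℚ) :* (l :* p :- (p :* p :+ con (- 1ℚ)))) refl (seq p i) l

  lucas≥1 : ∀ n → 1 ℕ.≤ lucas n
  lucas≥1 zero          = ℕ.s≤s ℕ.z≤n
  lucas≥1 (suc zero)    = ℕ.s≤s ℕ.z≤n
  lucas≥1 (suc (suc n)) = ℕP.≤-trans (lucas≥1 (suc n)) (ℕP.m≤m+n (lucas (suc n)) (lucas n))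

  /-clear : ∀ i d → i / suc d * fromℕ (suc d) ≡ i / 1
  /-clear i d = toℚᵘ-injective (begin
    toℚᵘ (i / suc d * fromℕ (suc d))             ≈⟨ toℚᵘ-homo-* (i / suc d) (fromℕ (suc d)) ⟩
    toℚᵘ (i / suc d) ℚᵘ.* toℚᵘ (fromℕ (suc d))   ≈⟨ ℚᵘP.*-cong (toℚᵘ-fromℚᵘ (mkℚᵘ i d)) (toℚᵘ-fromℚᵘ (mkℚᵘ (+ suc d) 0)) ⟩
    mkℚᵘ i d ℚᵘ.* mkℚᵘ (+ suc d) 0               ≈⟨ *≡* (trans (ℤP.*-identityʳ _)
                                                      (cong (λ z → i ℤ.* + z) (sym (ℕP.*-identityʳ (suc d))))) ⟩
    mkℚᵘ i 0                                     ≈⟨ toℚᵘ-fromℚᵘ (mkℚᵘ i 0) ⟨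
    toℚᵘ (i / 1)                                 ∎)
    where open ℚᵘP.≃-Reasoning

  /1-minus : ∀ m → (+ m ℤ.- + 2) / 1 ≡ fromℕ m - 2ℚ
  /1-minus m = toℚᵘ-injective (begin
    toℚᵘ ((+ m ℤ.- + 2) / 1)                     ≈⟨ toℚᵘ-fromℚᵘ (mkℚᵘ (+ m ℤ.- + 2) 0) ⟩
    mkℚᵘ (+ m ℤ.- + 2) 0                         ≈⟨ *≡* (cong (ℤ._* + 1) (cong (ℤ._+ ℤ.- + 2) (sym (ℤP.*-identityʳ (+ m))))) ⟩
    mkℚᵘ (+ m) 0 ℚᵘ.+ toℚᵘ (- 2ℚ)                ≈⟨ ℚᵘP.+-congˡ (toℚᵘ (- 2ℚ)) (toℚᵘ-fromℚᵘ (mkℚᵘ (+ m) 0)) ⟨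
    toℚᵘ (fromℕ m) ℚᵘ.+ toℚᵘ (- 2ℚ)              ≈⟨ toℚᵘ-homo-+ (fromℕ m) (- 2ℚ) ⟨
    toℚᵘ (fromℕ m - 2ℚ)                          ∎)
    where open ℚᵘP.≃-Reasoning

  ratio-clear : ∀ m → (+ m ℤ.- + 2) / (2 ℕ.+ m) * (2ℚ + fromℕ m) ≡ fromℕ m - 2ℚ
  ratio-clear m = trans (cong ((+ m ℤ.- + 2) / (2 ℕ.+ m) *_) (sym (fromℕ-+ 2 m)))
    (trans (/-clear (+ m ℤ.- + 2) (suc m)) (/1-minus m))

  -- The arctangent and the final identity

  module _ {π : ℝ} (isPi : IsPi π) {arctan : ℝ → ℝ} (isArctan : IsArctan π arctan) where

    open IsArctan isArctan

    arctan-above : ∀ x → Pos (half π +ℝ arctan x)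
    arctan-above x = Pos-pointwise {arctan x -ℝ (-ℝ (fromℚ ½ *ℝ π))}
      (λ n → solve 2 (λ π a → a :- (:- (con ½ :* π)) := con ½ :* π :+ a) refl (seq π n) (seq (arctan x) n))
      (<⇒Pos { -ℝ (fromℚ ½ *ℝ π)} {arctan x} (arctan-lower x))

    arctan-below : ∀ x → Pos (half π -ℝ arctan x)
    arctan-below x = Pos-pointwise {(fromℚ ½ *ℝ π) -ℝ arctan x}
      (λ n → solve 2 (λ π a → con ½ :* π :- a := con ½ :* π :- a) refl (seq π n) (seq (arctan x) n))
      (<⇒Pos {arctan x} {fromℚ ½ *ℝ π} (arctan-upper x))

    sin-arctan : ∀ x → sin (arctan x) ≈ x *ℝ cos (arctan x)
    sin-arctan x = tan-sin (arctan x) (cos-arctan x) x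
      (≈-intro {tan (arctan x) (cos-arctan x)} {x} (tan-arctan x))

    arctan-sum : ∀ X P L Y → Pos P → P *ℝ X ≈ 1ℝ → 0ℚ < L → P *ℝ P ≈ fromℚ L *ℝ P +ℝ 1ℝ →
      Y * (2ℚ + L) ≡ L - 2ℚ → fromℚ (+ 1 / 4) *ℝ π ≈ fromℚ (+ 2 / 1) *ℝ arctan X +ℝ arctan (fromℚ Y)
    arctan-sum X P L Y 0<P PX≈1 0<L P²≈ Y≡ = Trigonometry.AngleSum.angle-sum isPi
      {arctan X} {arctan (fromℚ Y)} {X} {P} {L} {Y}
      (arctan-above X) (arctan-below X) (arctan-above (fromℚ Y)) (arctan-below (fromℚ Y))
      (0<⇒Pos {cos (arctan X)} (cos-arctan X)) (sin-arctan X) (sin-arctan (fromℚ Y))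
      0<P PX≈1 0<L P²≈ Y≡

    lucas-arctan : ∀ n → parity n ≡ - 1ℚ →
      fromℚ (+ 1 / 4) *ℝ π ≈ fromℚ (+ 2 / 1) *ℝ arctan (recip (φ ^ℝ n) (^ℝ-pos {φ} φ-pos n))
                  +ℝ arctan (fromℚ ((+ lucas n ℤ.- + 2) / (2 ℕ.+ lucas n)))
    lucas-arctan n odd = arctan-sum (recip (φ ^ℝ n) (^ℝ-pos {φ} φ-pos n)) (φ ^ℝ n)
      (fromℕ (lucas n)) ((+ lucas n ℤ.- + 2) / (2 ℕ.+ lucas n))
      (0<⇒Pos {φ ^ℝ n} (^ℝ-pos {φ} φ-pos n)) (recip-inverse (φ ^ℝ n) (^ℝ-pos {φ} φ-pos n))
      (<-≤-trans 0<1 (fromℕ-mono (lucas≥1 n))) (lucas-φ-odd {n} odd) (ratio-clear (lucas n))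

open Analysis using (lucas-arctan; parity-odd; ≈-elim)
open import Data.Nat using (ℕ; _+_; _*_)
open import Data.Integer using (+_; _-_)
open import Data.Rational using (_/_)

mainTheorem4 : (π : ℝ) → IsPi π → (arctan : ℝ → ℝ) → IsArctan π arctan → (k : ℕ) →
    fromℚ (+ 1 / 4) *ℝ π
      ≃ fromℚ (+ 2 / 1) *ℝ arctan (recip (φ ^ℝ (2 * k + 1)) (^ℝ-pos {φ} φ-pos (2 * k + 1)))
        +ℝ arctan (fromℚ ((+ lucas (2 * k + 1) - + 2) / (2 + lucas (2 * k + 1))))
mainTheorem4 π isPi arctan isArctan k = ≈-elim (lucas-arctan isPi isArctan (2 * k + 1) (parity-odd k))
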